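{- Let $\mathbf a$ and $\mathbf b$ be compositions of $n$ with $\mathbf a\ge\mathbf b$, and suppose $\mathbf a$ is not a single block of odd size. Then \[ |\Phi^{ -1}_{\mathbf a}(D(\mathbf a))|\ge|\Phi^{ -1}_{\mathbf b}(D(\mathbf b))|. \]
   Context: A composition $\mathbf a=(a_1,\dots,a_k)$ of $n$ is a sequence of nonnegative integers with sum $n$; put $c_j=a_1+\dots+a_j$ ($c_0=0$) and blocks $A_j=\{c_{j-1}+1,\dots,c_j\}$. $S_{\mathbf a}$ is the set of permutations $\pi$ of $[n]$ with $\pi_i>\pi_{i+1}$ whenever $i,i+1$ lie in the same block; $D(\mathbf a)$ is the set of derangements in $S_{\mathbf a}$. The map $\Phi_{\mathbf a}:S_n\to S_{\mathbf a}$ sorts the entries within each block into decreasing order. For compositions $\mathbf a,\mathbf b$ of $n$, $\mathbf a\ge\mathbf b$ means that, after sorting the parts of each in decreasing order, $\sum_{i\le j}a_i\ge\sum_{i\le j}b_i$ for all $j$. "A single block of odd size" means $\mathbf a$ has only one nonzero part and $n$ is odd. -}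

module Defs where

open import Data.Nat using (ℕ; zero; suc; _+_; _≤_; _≥_; _≤?_; _≟_)
open import Data.Nat.Properties using ()
open import Data.Nat.ListAction using (sum)
open import Data.Bool using (Bool; true; false; if_then_else_)
open import Data.List using (List; []; _∷_; map; concatMap; take; drop; length; filter; zip; upTo; applyUpTo)
open import Data.List.Relation.Unary.All using (All; all?)
open import Data.Product using (_×_; _,_; proj₁; proj₂)
open import Relation.Nullary using (¬_; Dec; yes; no)
open import Relation.Nullary.Decidable using (¬?; ⌊_⌋)
open import Relation.Binary.PropositionalEquality using (_≡_; _≢_)
open import Data.Nat.Properties using (_≟_)

IsComposition : ℕ → List ℕ → Set
IsComposition n a = sum a ≡ n

insertDesc : ℕ → List ℕ → List ℕ
insertDesc x [] = x ∷ []
insertDesc x (y ∷ ys) = if ⌊ y Data.Nat.≤? x ⌋ then x ∷ y ∷ ys else y ∷ insertDesc x ys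

sortDesc : List ℕ → List ℕ
sortDesc [] = []
sortDesc (x ∷ xs) = insertDesc x (sortDesc xs)

_⊵_ : List ℕ → List ℕ → Set
a ⊵ b = ∀ (j : ℕ) → sum (take j (sortDesc a)) ≥ sum (take j (sortDesc b))

nonzeroParts : List ℕ → ℕ
nonzeroParts [] = 0
nonzeroParts (zero ∷ xs) = nonzeroParts xs
nonzeroParts (suc _ ∷ xs) = suc (nonzeroParts xs)

data Odd : ℕ → Set where
  odd-one : Odd 1
  odd-ss  : ∀ {m} → Odd m → Odd (suc (suc m))

SingleOddBlock : ℕ → List ℕ → Set
SingleOddBlock n a = (nonzeroParts a ≡ 1) × Odd n

inserts : ℕ → List ℕ → List (List ℕ)
inserts x [] = (x ∷ []) ∷ []
inserts x (y ∷ ys) = (x ∷ y ∷ ys) ∷ map (y ∷_) (inserts x ys)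

perms : List ℕ → List (List ℕ)
perms [] = [] ∷ []
perms (x ∷ xs) = concatMap (inserts x) (perms xs)

[_] : ℕ → List ℕ
[ n ] = applyUpTo suc n

Sym : ℕ → List (List ℕ)
Sym n = perms [ n ]

blocks : List ℕ → List ℕ → List (List ℕ)
blocks [] w = []
blocks (k ∷ ks) w = take k w ∷ blocks ks (drop k w)

Φ : List ℕ → List ℕ → List ℕ
Φ a π = concatMap sortDesc (blocks a π)

Derangement : List ℕ → Set
Derangement σ = All (λ p → proj₂ p ≢ proj₁ p) (zip [ length σ ] σ)

derangement? : (σ : List ℕ) → Dec (Derangement σ)
derangement? σ = all? (λ p → ¬? (proj₂ p ≟ proj₁ p)) (zip [ length σ ] σ)

-- |Φ_a⁻¹(D(a))| : number of π ∈ S_n with Φ_a(π) a derangement.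
-- (Φ_a(π) always lies in S_a, so Φ_a(π) ∈ D(a) iff Φ_a(π) is a derangement.)
preimageCount : ℕ → List ℕ → ℕ
preimageCount n a = length (filter (λ π → derangement? (Φ a π)) (Sym n))

{-# OPTIONS --safe #-}
module Submission where

open import Defs
open import Data.Bool using (true; false; if_then_else_)
open import Data.Integer.Base using (ℤ; +_; -[1+_]; 0ℤ; 1ℤ; _+_; _-_; _*_; -_; _≤_; +≤+)
open import Data.Integer.Properties
open import Data.Integer.Tactic.RingSolver using (solve-∀)
open import Data.List using (List)
open import Data.List.Base
  using ([]; _∷_; _++_; map; concatMap; foldr; take; drop; length; filter; zip; applyUpTo; replicate)
open import Data.List.Properties
  using (map-++; map-∘; ++-assoc; length-++; length-map; length-take; length-drop; length-replicate; take++drop≡id)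
open import Data.List.Relation.Binary.Permutation.Propositional as ↭ using (_↭_; ↭-refl; ↭-sym; ↭-trans)
open import Data.List.Relation.Binary.Permutation.Propositional.Properties using (shift; map⁺; ++⁺ˡ; ++-comm)
open import Data.List.Relation.Binary.Pointwise.Base using (Pointwise; []; _∷_)
open import Data.List.Relation.Unary.All as All using (All; []; _∷_; all?)
import Data.List.Relation.Unary.All.Properties as All
open import Data.List.Relation.Unary.AllPairs using (AllPairs; []; _∷_)
import Data.List.Relation.Unary.AllPairs.Properties as AllPairs
open import Data.Nat using (ℕ; _≥_)
open import Data.Nat.Base as ℕ using (zero; suc; _!; z≤n; s≤s)
open import Data.Nat.ListAction using (sum; product)
open import Data.Nat.ListAction.Properties using (sum-++; sum-↭; product-↭)
import Data.Nat.Properties as ℕ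
open import Data.Nat.Tactic.RingSolver renaming (solve-∀ to solve-∀ℕ)
open import Data.Product using (_×_; _,_; proj₁; proj₂; ∃; ∃₂)
open import Data.Sum using (_⊎_; inj₁; inj₂)
open import Function using (_∘_)
open import Relation.Binary.Definitions using (tri<; tri≈; tri>)
open import Relation.Binary.PropositionalEquality
open import Relation.Nullary using (¬_; yes; no; does; contradiction)
open import Relation.Nullary.Decidable using (¬?; dec-true; dec-false)

-- Let L be the linear functional with L x^n = n!, and let p_m = x^m - m p_{m-1}, p_0 = 1. Placing the values
-- 1, …, n one after the other, and integrating by parts, shows that the number of π with Φ_a(π) a derangement is
-- L (∏ p_{a_i}). It thus suffices to compare p_{a+1} p_b with p_a p_{b+1} for a > b, in the presence of a product R
-- of other p_c: majorization is generated by such moves. The finite differences at 0 of j ↦ L (x^j/j! R) are the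
-- coordinates of R in the signed Laguerre basis; they are nonnegative, and multiplication by p_c preserves this
-- since p_c/c! is a sum of differences x^j/j! - x^{j-1}/(j-1)!, plus 1 for even c. The coefficient array W
-- of the comparison satisfies (1 + t)(1 + v)(1 - t - v) W = Y with
-- (1 + t)(1 + v)(1 - t - v) = 1 - s₂ - s₂₁, so W inherits positivity above the diagonal from Y, because
-- multiplication by Schur polynomials preserves antisymmetric series with nonnegative coefficients for i > j.
-- Positivity of Y needs the second backward differences of j ↦ L (x^j/j! R) to be nonnegative, which holds as soon
-- as R has a nonconstant factor; R = 1 is treated by hand, and there the single odd block is the only exception.

-- Counting by placing the values in increasing order

differ : ℕ → ℕ → ℕ
differ x y = if does (x ℕ.≟ y) then 0 else 1

-- A numerical indicator in place of a decision: it is multiplicative over concatenation, so counts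
-- split block by block. Here `σ` occupies the positions from `suc o` on.
deranged : ℕ → List ℕ → ℕ
deranged o []      = 1
deranged o (x ∷ σ) = differ x (suc o) ℕ.* deranged (suc o) σ

deranged-++ : ∀ o σ τ → deranged o (σ ++ τ) ≡ deranged o σ ℕ.* deranged (o ℕ.+ length σ) τ
deranged-++ o []      τ = trans (cong (λ p → deranged p τ) (sym (ℕ.+-identityʳ o))) (sym (ℕ.*-identityˡ _))
deranged-++ o (x ∷ σ) τ = trans (cong (differ x (suc o) ℕ.*_)
  (trans (deranged-++ (suc o) σ τ) (cong (λ p → deranged (suc o) σ ℕ.* deranged p τ) (sym (ℕ.+-suc o (length σ))))))
  (sym (ℕ.*-assoc (differ x (suc o)) _ _))

-- `f` stays general because unfolding `applyUpTo` replaces it by `f ∘ suc`.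
deranged-dec : ∀ f o σ → (∀ i → f i ≡ suc (o ℕ.+ i)) →
  (if does (all? (λ p → ¬? (proj₂ p ℕ.≟ proj₁ p)) (zip (applyUpTo f (length σ)) σ)) then 1 else 0) ≡ deranged o σ
deranged-dec f o []      h = refl
deranged-dec f o (x ∷ σ) h rewrite h 0 | ℕ.+-identityʳ o with does (x ℕ.≟ suc o)
... | true  = refl
... | false = trans (deranged-dec (f ∘ suc) (suc o) σ (λ i → trans (h (suc i)) (cong suc (ℕ.+-suc o i))))
                    (sym (ℕ.*-identityˡ _))

∑ : ∀ {A : Set} → (A → ℕ) → List A → ℕ
∑ f xs = sum (map f xs)

∑-++ : ∀ {A : Set} (f : A → ℕ) xs ys → ∑ f (xs ++ ys) ≡ ∑ f xs ℕ.+ ∑ f ys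
∑-++ f xs ys = trans (cong sum (map-++ f xs ys)) (sum-++ (map f xs) (map f ys))

∑-map : ∀ {A B : Set} (f : B → ℕ) (g : A → B) xs → ∑ f (map g xs) ≡ ∑ (f ∘ g) xs
∑-map f g xs = cong sum (sym (map-∘ xs))

∑-cong : ∀ {A : Set} {f g : A → ℕ} {xs} → All (λ x → f x ≡ g x) xs → ∑ f xs ≡ ∑ g xs
∑-cong []       = refl
∑-cong (e ∷ es) = cong₂ ℕ._+_ e (∑-cong es)

∑-concatMap : ∀ {A B : Set} (f : B → ℕ) (g : A → List B) xs → ∑ f (concatMap g xs) ≡ ∑ (λ x → ∑ f (g x)) xs
∑-concatMap f g []       = refl
∑-concatMap f g (x ∷ xs) = trans (∑-++ f (g x) (concatMap g xs)) (cong (∑ f (g x) ℕ.+_) (∑-concatMap f g xs))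

∑-const : ∀ {A : Set} {f : A → ℕ} {c xs} → All (λ x → f x ≡ c) xs → ∑ f xs ≡ length xs ℕ.* c
∑-const []       = refl
∑-const (e ∷ es) = cong₂ ℕ._+_ e (∑-const es)

∑-+ : ∀ {A : Set} (f g : A → ℕ) xs → ∑ (λ x → f x ℕ.+ g x) xs ≡ ∑ f xs ℕ.+ ∑ g xs
∑-+ f g []       = refl
∑-+ f g (x ∷ xs) = trans (cong (f x ℕ.+ g x ℕ.+_) (∑-+ f g xs)) (alg (f x) (g x) (∑ f xs) (∑ g xs))
  where
  alg : ∀ a b c d → a ℕ.+ b ℕ.+ (c ℕ.+ d) ≡ a ℕ.+ c ℕ.+ (b ℕ.+ d)
  alg = solve-∀ℕ

∑-* : ∀ {A : Set} c (f : A → ℕ) xs → ∑ (λ x → c ℕ.* f x) xs ≡ c ℕ.* ∑ f xs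
∑-* c f []       = sym (ℕ.*-zeroʳ c)
∑-* c f (x ∷ xs) = trans (cong (c ℕ.* f x ℕ.+_) (∑-* c f xs)) (sym (ℕ.*-distribˡ-+ c (f x) (∑ f xs)))

length-filter-deranged : ∀ a (xs : List (List ℕ)) →
  length (filter (λ π → derangement? (Φ a π)) xs) ≡ ∑ (deranged 0 ∘ Φ a) xs
length-filter-deranged a [] = refl
length-filter-deranged a (x ∷ xs)
  with does (derangement? (Φ a x)) | deranged-dec suc 0 (Φ a x) (λ _ → refl)
... | true  | e = cong₂ ℕ._+_ e (length-filter-deranged a xs)
... | false | e = cong₂ ℕ._+_ e (length-filter-deranged a xs)

-- A block (o , r) starts after position o and has r free positions, the last of which is o + r.
Block : Set
Block = ℕ × ℕ

capacity : List Block → ℕ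
capacity bl = sum (map proj₂ bl)

derangedBlocks : List Block → List ℕ → ℕ
derangedBlocks []             w = 1
derangedBlocks ((o , r) ∷ bl) w = deranged o (sortDesc (take r w)) ℕ.* derangedBlocks bl (drop r w)

toBlocks : ℕ → List ℕ → List Block
toBlocks o []      = []
toBlocks o (k ∷ a) = (o , k) ∷ toBlocks (k ℕ.+ o) a

length-insertDesc : ∀ x s → length (insertDesc x s) ≡ suc (length s)
length-insertDesc x []      = refl
length-insertDesc x (y ∷ s) with y ℕ.≤? x
... | yes _ = refl
... | no  _ = cong suc (length-insertDesc x s)

length-sortDesc : ∀ s → length (sortDesc s) ≡ length s
length-sortDesc []      = refl
length-sortDesc (x ∷ s) = trans (length-insertDesc x (sortDesc s)) (cong suc (length-sortDesc s))

length-take-≤ : ∀ r (w : List ℕ) → r ℕ.≤ length w → length (take r w) ≡ r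
length-take-≤ r w r≤ = trans (length-take r w) (ℕ.m≤n⇒m⊓n≡m r≤)

deranged-Φ : ∀ a o w → sum a ℕ.≤ length w → deranged o (Φ a w) ≡ derangedBlocks (toBlocks o a) w
deranged-Φ []      o w _ = refl
deranged-Φ (k ∷ a) o w le = trans (deranged-++ o (sortDesc (take k w)) (Φ a (drop k w)))
  (cong (deranged o (sortDesc (take k w)) ℕ.*_)
    (trans (cong (λ p → deranged p (Φ a (drop k w)))
             (trans (cong (o ℕ.+_) (trans (length-sortDesc (take k w)) (length-take-≤ k w (ℕ.m+n≤o⇒m≤o k le)))) (ℕ.+-comm o k)))
           (deranged-Φ a (k ℕ.+ o) (drop k w)
             (ℕ.≤-trans (ℕ.≤-reflexive (sym (ℕ.m+n∸m≡n k (sum a))))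
               (ℕ.≤-trans (ℕ.∸-monoˡ-≤ k le) (ℕ.≤-reflexive (sym (length-drop k w))))))))

-- Insertion at the front is left out: in `s ++ t` that position already counts as the end of `s`.
inserts⁺ : ℕ → List ℕ → List (List ℕ)
inserts⁺ v []      = []
inserts⁺ v (y ∷ t) = map (y ∷_) (inserts v t)

inserts-++ : ∀ v s t → inserts v (s ++ t) ≡ map (_++ t) (inserts v s) ++ map (s ++_) (inserts⁺ v t)
inserts-++ v [] []      = refl
inserts-++ v [] (y ∷ t) = cong ((v ∷ y ∷ t) ∷_) (map-∘ (inserts v t))
inserts-++ v (x ∷ s) t = cong ((v ∷ x ∷ s ++ t) ∷_) (trans (cong (map (x ∷_)) (inserts-++ v s t))
  (trans (map-++ (x ∷_) (map (_++ t) (inserts v s)) (map (s ++_) (inserts⁺ v t)))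
  (cong₂ _++_
    (trans (sym (map-∘ (inserts v s))) (map-∘ (inserts v s)))
    (sym (map-∘ (inserts⁺ v t))))))

length-inserts : ∀ v s → length (inserts v s) ≡ suc (length s)
length-inserts v []      = refl
length-inserts v (x ∷ s) = cong suc (trans (length-map (x ∷_) (inserts v s)) (length-inserts v s))

insertDesc-min : ∀ {v} s → All (v ℕ.<_) s → insertDesc v s ≡ s ++ v ∷ []
insertDesc-min []      [] = refl
insertDesc-min {v} (y ∷ s) (v<y ∷ h) with y ℕ.≤? v
... | yes y≤v = contradiction v<y (ℕ.≤⇒≯ y≤v)
... | no  _   = cong (y ∷_) (insertDesc-min s h)

insertDesc-∷ʳ : ∀ {v x} s → v ℕ.< x → insertDesc x (s ++ v ∷ []) ≡ insertDesc x s ++ v ∷ []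
insertDesc-∷ʳ {v} {x} [] v<x with v ℕ.≤? x
... | yes _   = refl
... | no  v≰x = contradiction (ℕ.<⇒≤ v<x) v≰x
insertDesc-∷ʳ {v} {x} (y ∷ s) v<x with y ℕ.≤? x
... | yes _ = refl
... | no  _ = cong (y ∷_) (insertDesc-∷ʳ s v<x)

All-insertDesc : ∀ {P : ℕ → Set} {x} s → P x → All P s → All P (insertDesc x s)
All-insertDesc []      p [] = p ∷ []
All-insertDesc {x = x} (y ∷ s) p (q ∷ h) with y ℕ.≤? x
... | yes _ = p ∷ q ∷ h
... | no  _ = q ∷ All-insertDesc s p h

All-sortDesc : ∀ {P : ℕ → Set} s → All P s → All P (sortDesc s)
All-sortDesc []      []      = []
All-sortDesc (x ∷ s) (p ∷ h) = All-insertDesc (sortDesc s) p (All-sortDesc s h)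

-- Sorting moves the minimum to the end from wherever it was inserted, so all insertions into one
-- block contribute alike.
sortDesc-inserts : ∀ {v} s → All (v ℕ.<_) s →
  All (λ s′ → sortDesc s′ ≡ sortDesc s ++ v ∷ [] × length s′ ≡ suc (length s)) (inserts v s)
sortDesc-inserts []      []        = (refl , refl) ∷ []
sortDesc-inserts (x ∷ s) (v<x ∷ h) =
  (insertDesc-min (sortDesc (x ∷ s)) (All-sortDesc (x ∷ s) (v<x ∷ h)) , refl) ∷
  All.map⁺ (All.map (λ { (e , l) → trans (cong (insertDesc x) e) (insertDesc-∷ʳ (sortDesc s) v<x) , cong suc l })
                    (sortDesc-inserts s h))

All-inserts : ∀ {P : ℕ → Set} {v s} → P v → All P s → All (λ s′ → All P s′ × length s′ ≡ suc (length s)) (inserts v s)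
All-inserts p []      = (p ∷ [] , refl) ∷ []
All-inserts p (q ∷ h) = (p ∷ q ∷ h , refl) ∷ All.map⁺ (All.map (λ { (h′ , l) → q ∷ h′ , cong suc l }) (All-inserts p h))

All-perms : ∀ {P : ℕ → Set} {s} → All P s → All (λ w → All P w × length w ≡ length s) (perms s)
All-perms []      = ([] , refl) ∷ []
All-perms (p ∷ h) = All.concat⁺ (All.map⁺ (All.map
  (λ { (h′ , l) → All.map (λ { (h″ , l′) → h″ , trans l′ (cong suc l) }) (All-inserts p h′) }) (All-perms h)))

-- Values are placed in increasing order, so sorting moves v to the last free position o + r of its block;
-- the factor suc r counts the positions v can have before sorting.
place : ℕ → (List Block → ℕ) → List Block → ℕ
place v F []                 = 0
place v F ((o , zero)  ∷ bl) = place v (λ bl′ → F ((o , zero) ∷ bl′)) bl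
place v F ((o , suc r) ∷ bl) =
  suc r ℕ.* (differ v (o ℕ.+ suc r) ℕ.* F ((o , r) ∷ bl)) ℕ.+ place v (λ bl′ → F ((o , suc r) ∷ bl′)) bl

place-cong : ∀ {v F G} bl → (∀ bl′ → suc (capacity bl′) ≡ capacity bl → F bl′ ≡ G bl′) →
  place v F bl ≡ place v G bl
place-cong []                 h = refl
place-cong ((o , zero)  ∷ bl) h = place-cong bl (λ bl′ → h ((o , zero) ∷ bl′))
place-cong {v} ((o , suc r) ∷ bl) h = cong₂ ℕ._+_ (cong (λ x → suc r ℕ.* (differ v (o ℕ.+ suc r) ℕ.* x)) (h _ refl))
  (place-cong bl (λ bl′ e → h ((o , suc r) ∷ bl′) (trans (sym (ℕ.+-suc (suc r) (capacity bl′))) (cong (suc r ℕ.+_) e))))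

place-* : ∀ v c F bl → place v (λ bl′ → c ℕ.* F bl′) bl ≡ c ℕ.* place v F bl
place-* v c F []                 = sym (ℕ.*-zeroʳ c)
place-* v c F ((o , zero)  ∷ bl) = place-* v c _ bl
place-* v c F ((o , suc r) ∷ bl) =
  trans (cong₂ ℕ._+_ (alg (suc r) (differ v (o ℕ.+ suc r)) c (F ((o , r) ∷ bl))) (place-* v c _ bl))
        (sym (ℕ.*-distribˡ-+ c _ _))
  where
  alg : ∀ r d c f → r ℕ.* (d ℕ.* (c ℕ.* f)) ≡ c ℕ.* (r ℕ.* (d ℕ.* f))
  alg = solve-∀ℕ

place-∑ : ∀ {A : Set} v (F : A → List Block → ℕ) xs bl →
  ∑ (λ x → place v (F x) bl) xs ≡ place v (λ bl′ → ∑ (λ x → F x bl′) xs) bl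
place-∑ v F xs []                 = trans (∑-const {c = 0} (All.universal (λ _ → refl) xs)) (ℕ.*-zeroʳ (length xs))
place-∑ v F xs ((o , zero)  ∷ bl) = place-∑ v _ xs bl
place-∑ v F xs ((o , suc r) ∷ bl) = trans (∑-+ _ _ xs)
  (cong₂ ℕ._+_ (trans (∑-* (suc r) _ xs) (cong (suc r ℕ.*_) (∑-* (differ v (o ℕ.+ suc r)) _ xs))) (place-∑ v _ xs bl))

place-full : ∀ v F bl → capacity bl ≡ 0 → place v F bl ≡ 0
place-full v F []                e = refl
place-full v F ((o , zero) ∷ bl) e = place-full v _ bl e

splitAt-length : ∀ r (w : List ℕ) → r ℕ.≤ length w → ∃₂ λ s t → w ≡ s ++ t × length s ≡ r
splitAt-length r w r≤ = take r w , drop r w , sym (take++drop≡id r w) , length-take-≤ r w r≤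

take-++-length : ∀ (s t : List ℕ) → take (length s) (s ++ t) ≡ s
take-++-length []      t = refl
take-++-length (x ∷ s) t = cong (x ∷_) (take-++-length s t)

drop-++-length : ∀ (s t : List ℕ) → drop (length s) (s ++ t) ≡ t
drop-++-length []      t = refl
drop-++-length (x ∷ s) t = drop-++-length s t

derangedBlocks-++ : ∀ o s t bl →
  derangedBlocks ((o , length s) ∷ bl) (s ++ t) ≡ deranged o (sortDesc s) ℕ.* derangedBlocks bl t
derangedBlocks-++ o s t bl = cong₂ (λ x y → deranged o (sortDesc x) ℕ.* derangedBlocks bl y)
  (take-++-length s t) (drop-++-length s t)

∑-inserts : ∀ {v} w bl → All (v ℕ.<_) w → capacity bl ≡ suc (length w) →
  ∑ (derangedBlocks bl) (inserts v w) ≡ place v (λ bl′ → derangedBlocks bl′ w) bl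
∑-inserts w ((o , zero) ∷ bl) h e = begin
  ∑ (λ w′ → 1 ℕ.* derangedBlocks bl w′) (inserts _ w) ≡⟨ ∑-* 1 (derangedBlocks bl) (inserts _ w) ⟩
  1 ℕ.* ∑ (derangedBlocks bl) (inserts _ w)           ≡⟨ cong (1 ℕ.*_) (∑-inserts w bl h e) ⟩
  1 ℕ.* place _ (λ bl′ → derangedBlocks bl′ w) bl     ≡⟨ sym (place-* _ 1 _ bl) ⟩
  place _ (λ bl′ → 1 ℕ.* derangedBlocks bl′ w) bl     ∎
  where open ≡-Reasoning
∑-inserts {v} w ((o , suc r) ∷ bl) h e
  -- If `v` enters the first block, the `r` letters of `s` fill the rest of it; otherwise the block
  -- also takes the first letter of `t`.
  with s , t , refl , refl ← splitAt-length r w (ℕ.≤-trans (ℕ.m≤m+n r (capacity bl)) (ℕ.≤-reflexive (ℕ.suc-injective e)))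
  = trans (trans (cong (∑ D) (inserts-++ v s t)) (∑-++ D (map (_++ t) (inserts v s)) _))
          (cong₂ ℕ._+_ inside (outside t h (ℕ.+-cancelˡ-≡ (length s) _ _ (trans (ℕ.suc-injective e) (length-++ s)))))
  where
  open ≡-Reasoning
  D = derangedBlocks ((o , suc (length s)) ∷ bl)

  hs : All (v ℕ.<_) s
  hs = All.++⁻ˡ s h

  inside : ∑ D (map (_++ t) (inserts v s)) ≡
    suc (length s) ℕ.* (differ v (o ℕ.+ suc (length s)) ℕ.* derangedBlocks ((o , length s) ∷ bl) (s ++ t))
  inside = trans (∑-map D (_++ t) (inserts v s)) (trans (∑-const (All.map (λ {s′} → each {s′}) (sortDesc-inserts s hs)))
    (cong (ℕ._* (differ v (o ℕ.+ suc (length s)) ℕ.* derangedBlocks ((o , length s) ∷ bl) (s ++ t))) (length-inserts v s)))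
    where
    alg : ∀ a b c → a ℕ.* (b ℕ.* 1) ℕ.* c ≡ b ℕ.* (a ℕ.* c)
    alg = solve-∀ℕ
    each : ∀ {s′} → sortDesc s′ ≡ sortDesc s ++ v ∷ [] × length s′ ≡ suc (length s) →
      D (s′ ++ t) ≡ differ v (o ℕ.+ suc (length s)) ℕ.* derangedBlocks ((o , length s) ∷ bl) (s ++ t)
    each {s′} (es , l) = begin
      D (s′ ++ t)
        ≡⟨ cong (λ r → derangedBlocks ((o , r) ∷ bl) (s′ ++ t)) (sym l) ⟩
      derangedBlocks ((o , length s′) ∷ bl) (s′ ++ t)
        ≡⟨ derangedBlocks-++ o s′ t bl ⟩
      deranged o (sortDesc s′) ℕ.* derangedBlocks bl t
        ≡⟨ cong (λ x → deranged o x ℕ.* derangedBlocks bl t) es ⟩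
      deranged o (sortDesc s ++ v ∷ []) ℕ.* derangedBlocks bl t
        ≡⟨ cong (ℕ._* derangedBlocks bl t) (deranged-++ o (sortDesc s) (v ∷ [])) ⟩
      deranged o (sortDesc s) ℕ.* (differ v (suc (o ℕ.+ length (sortDesc s))) ℕ.* 1) ℕ.* derangedBlocks bl t
        ≡⟨ alg (deranged o (sortDesc s)) (differ v _) (derangedBlocks bl t) ⟩
      differ v (suc (o ℕ.+ length (sortDesc s))) ℕ.* (deranged o (sortDesc s) ℕ.* derangedBlocks bl t)
        ≡⟨ cong₂ (λ p q → differ v p ℕ.* q)
             (trans (cong (λ l → suc (o ℕ.+ l)) (length-sortDesc s)) (sym (ℕ.+-suc o (length s))))
             (sym (derangedBlocks-++ o s t bl)) ⟩
      differ v (o ℕ.+ suc (length s)) ℕ.* derangedBlocks ((o , length s) ∷ bl) (s ++ t) ∎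

  outside : ∀ t → All (v ℕ.<_) (s ++ t) → capacity bl ≡ length t →
    ∑ D (map (s ++_) (inserts⁺ v t)) ≡ place v (λ bl′ → derangedBlocks ((o , suc (length s)) ∷ bl′) (s ++ t)) bl
  outside []      h e = sym (place-full v _ bl e)
  outside (y ∷ t) h e = begin
    ∑ D (map (s ++_) (map (y ∷_) (inserts v t)))
      ≡⟨ trans (∑-map D (s ++_) (map (y ∷_) (inserts v t))) (∑-map (D ∘ (s ++_)) (y ∷_) (inserts v t)) ⟩
    ∑ (λ t′ → D (s ++ y ∷ t′)) (inserts v t)
      ≡⟨ ∑-cong (All.universal (λ t′ → D-++ bl t′) (inserts v t)) ⟩
    ∑ (λ t′ → deranged o (sortDesc (s ++ y ∷ [])) ℕ.* derangedBlocks bl t′) (inserts v t)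
      ≡⟨ ∑-* (deranged o (sortDesc (s ++ y ∷ []))) (derangedBlocks bl) (inserts v t) ⟩
    deranged o (sortDesc (s ++ y ∷ [])) ℕ.* ∑ (derangedBlocks bl) (inserts v t)
      ≡⟨ cong (deranged o (sortDesc (s ++ y ∷ [])) ℕ.*_)
           (∑-inserts t bl (All.tail (All.++⁻ʳ s h)) e) ⟩
    deranged o (sortDesc (s ++ y ∷ [])) ℕ.* place v (λ bl′ → derangedBlocks bl′ t) bl
      ≡⟨ sym (place-* v (deranged o (sortDesc (s ++ y ∷ []))) _ bl) ⟩
    place v (λ bl′ → deranged o (sortDesc (s ++ y ∷ [])) ℕ.* derangedBlocks bl′ t) bl
      ≡⟨ place-cong bl (λ bl′ _ → sym (D-++ bl′ t)) ⟩
    place v (λ bl′ → derangedBlocks ((o , suc (length s)) ∷ bl′) (s ++ y ∷ t)) bl ∎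
    where
    D-++ : ∀ bl t → derangedBlocks ((o , suc (length s)) ∷ bl) (s ++ y ∷ t) ≡
      deranged o (sortDesc (s ++ y ∷ [])) ℕ.* derangedBlocks bl t
    D-++ bl t = trans (cong₂ (λ r w → derangedBlocks ((o , r) ∷ bl) w)
        (trans (sym (ℕ.+-comm (length s) 1)) (sym (length-++ s)))
        (sym (++-assoc s (y ∷ []) t)))
      (derangedBlocks-++ o (s ++ y ∷ []) t bl)

range : ℕ → ℕ → List ℕ
range v zero    = []
range v (suc k) = v ∷ range (suc v) k

length-range : ∀ v k → length (range v k) ≡ k
length-range v zero    = refl
length-range v (suc k) = cong suc (length-range (suc v) k)

All-range : ∀ {u} v k → u ℕ.< v → All (u ℕ.<_) (range v k)
All-range v zero    _   = []
All-range v (suc k) u<v = u<v ∷ All-range (suc v) k (ℕ.m<n⇒m<1+n u<v)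

applyUpTo-range : ∀ f v k → (∀ i → f i ≡ v ℕ.+ i) → applyUpTo f k ≡ range v k
applyUpTo-range f v zero    h = refl
applyUpTo-range f v (suc k) h = cong₂ _∷_ (trans (h 0) (ℕ.+-identityʳ v))
  (applyUpTo-range (f ∘ suc) (suc v) k (λ i → trans (h (suc i)) (ℕ.+-suc v i)))

fillings : ℕ → ℕ → List Block → ℕ
fillings v zero    bl = 1
fillings v (suc k) bl = place v (fillings (suc v) k) bl

derangedBlocks-full : ∀ bl → capacity bl ≡ 0 → derangedBlocks bl [] ≡ 1
derangedBlocks-full []                e = refl
derangedBlocks-full ((o , zero) ∷ bl) e = trans (ℕ.*-identityˡ _) (derangedBlocks-full bl e)

-- `perms` inserts the head of the list, here the smallest value, into words of larger values, which
-- is the situation of `∑-inserts`.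
∑-perms : ∀ v k bl → capacity bl ≡ k → ∑ (derangedBlocks bl) (perms (range v k)) ≡ fillings v k bl
∑-perms v zero    bl e = trans (ℕ.+-identityʳ _) (derangedBlocks-full bl e)
∑-perms v (suc k) bl e = begin
  ∑ (derangedBlocks bl) (concatMap (inserts v) (perms (range (suc v) k)))
    ≡⟨ ∑-concatMap (derangedBlocks bl) (inserts v) (perms (range (suc v) k)) ⟩
  ∑ (λ w → ∑ (derangedBlocks bl) (inserts v w)) (perms (range (suc v) k))
    ≡⟨ ∑-cong (All.map (λ { {w} (h , l) → ∑-inserts w bl h
         (trans e (cong suc (sym (trans l (length-range (suc v) k))))) })
         (All-perms (All-range (suc v) k ℕ.≤-refl))) ⟩
  ∑ (λ w → place v (λ bl′ → derangedBlocks bl′ w) bl) (perms (range (suc v) k))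
    ≡⟨ place-∑ v (λ w bl′ → derangedBlocks bl′ w) (perms (range (suc v) k)) bl ⟩
  place v (λ bl′ → ∑ (derangedBlocks bl′) (perms (range (suc v) k))) bl
    ≡⟨ place-cong bl (λ bl′ e′ → ∑-perms (suc v) k bl′ (ℕ.suc-injective (trans e′ e))) ⟩
  place v (fillings (suc v) k) bl ∎
  where open ≡-Reasoning

capacity-toBlocks : ∀ o a → capacity (toBlocks o a) ≡ sum a
capacity-toBlocks o []      = refl
capacity-toBlocks o (k ∷ a) = cong (k ℕ.+_) (capacity-toBlocks (k ℕ.+ o) a)

preimageCount-fillings : ∀ n a → sum a ≡ n → preimageCount n a ≡ fillings 1 n (toBlocks 0 a)
preimageCount-fillings n a e = begin
  preimageCount n a
    ≡⟨ length-filter-deranged a (Sym n) ⟩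
  ∑ (deranged 0 ∘ Φ a) (Sym n)
    ≡⟨ cong (λ l → ∑ (deranged 0 ∘ Φ a) (perms l)) (applyUpTo-range suc 1 n (λ _ → refl)) ⟩
  ∑ (deranged 0 ∘ Φ a) (perms (range 1 n))
    ≡⟨ ∑-cong (All.map (λ { {w} (_ , l) → deranged-Φ a 0 w
         (ℕ.≤-reflexive (trans e (sym (trans l (length-range 1 n))))) }) (All-perms (All-range 1 n ℕ.z<s))) ⟩
  ∑ (derangedBlocks (toBlocks 0 a)) (perms (range 1 n))
    ≡⟨ ∑-perms 1 n (toBlocks 0 a) (trans (capacity-toBlocks 0 a) e) ⟩
  fillings 1 n (toBlocks 0 a) ∎
  where open ≡-Reasoning

-- Positivity

-- A sequence ρ stands for j ↦ L (x^j/j! · R) for some polynomial R, where L x^n = n!. Then ε a ρ and π a ρ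
-- stand for R · x^a/a! and R · p_a/a!, with p_a = x^a - a p_{a-1}.
Seq : Set
Seq = ℕ → ℤ

-- bin a b is the binomial coefficient C(a+b, a).
bin : ℕ → ℕ → ℕ
bin zero    b       = 1
bin (suc a) zero    = 1
bin (suc a) (suc b) = bin a (suc b) ℕ.+ bin (suc a) b

bin-zeroʳ : ∀ a → bin a 0 ≡ 1
bin-zeroʳ zero    = refl
bin-zeroʳ (suc a) = refl

bin-! : ∀ a b → bin a b ℕ.* (a ! ℕ.* b !) ≡ (a ℕ.+ b) !
bin-! zero b = solve1 (b !)
  where solve1 : ∀ x → 1 ℕ.* (1 ℕ.* x) ≡ x
        solve1 = solve-∀ℕ
bin-! (suc a) zero = trans (solve1 (suc a !)) (cong _! (sym (ℕ.+-identityʳ (suc a))))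
  where solve1 : ∀ x → 1 ℕ.* (x ℕ.* 1) ≡ x
        solve1 = solve-∀ℕ
bin-! (suc a) (suc b) = begin
  (x ℕ.+ y) ℕ.* (suc a ! ℕ.* suc b !)
    ≡⟨ regroup a b x y (a !) (b !) ⟩
  suc a ℕ.* (x ℕ.* (a ! ℕ.* suc b !)) ℕ.+ suc b ℕ.* (y ℕ.* (suc a ! ℕ.* b !))
    ≡⟨ cong₂ (λ u v → suc a ℕ.* u ℕ.+ suc b ℕ.* v) (bin-! a (suc b)) (bin-! (suc a) b) ⟩
  suc a ℕ.* (a ℕ.+ suc b) ! ℕ.+ suc b ℕ.* (suc a ℕ.+ b) !
    ≡⟨ cong (λ n → suc a ℕ.* (a ℕ.+ suc b) ! ℕ.+ suc b ℕ.* n !) (sym (ℕ.+-suc a b)) ⟩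
  suc a ℕ.* (a ℕ.+ suc b) ! ℕ.+ suc b ℕ.* (a ℕ.+ suc b) !
    ≡⟨ sym (ℕ.*-distribʳ-+ ((a ℕ.+ suc b) !) (suc a) (suc b)) ⟩
  (suc a ℕ.+ suc b) ! ∎
  where
  open ≡-Reasoning
  x = bin a (suc b)
  y = bin (suc a) b
  regroup : ∀ a b x y u v →
    (x ℕ.+ y) ℕ.* ((suc a ℕ.* u) ℕ.* (suc b ℕ.* v)) ≡
    suc a ℕ.* (x ℕ.* (u ℕ.* (suc b ℕ.* v))) ℕ.+ suc b ℕ.* (y ℕ.* ((suc a ℕ.* u) ℕ.* v))
  regroup = solve-∀ℕ

bin-sym : ∀ a b → bin a b ≡ bin b a
bin-sym zero    b       = sym (bin-zeroʳ b)
bin-sym (suc a) zero    = refl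
bin-sym (suc a) (suc b) = trans (cong₂ ℕ._+_ (bin-sym a (suc b)) (bin-sym (suc a) b))
                                (ℕ.+-comm (bin (suc b) a) (bin b (suc a)))

bin-absorb : ∀ a b → suc a ℕ.* bin (suc a) b ≡ suc b ℕ.* bin a (suc b)
bin-absorb a b = ℕ.*-cancelʳ-≡ _ _ (a ! ℕ.* b !) ⦃ a ℕ.!* b !≢0 ⦄ (begin
  suc a ℕ.* bin (suc a) b ℕ.* (a ! ℕ.* b !)   ≡⟨ l a (bin (suc a) b) (a !) (b !) ⟩
  bin (suc a) b ℕ.* (suc a ! ℕ.* b !)         ≡⟨ bin-! (suc a) b ⟩
  (suc a ℕ.+ b) !                             ≡⟨ cong _! (sym (ℕ.+-suc a b)) ⟩
  (a ℕ.+ suc b) !                             ≡⟨ sym (bin-! a (suc b)) ⟩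
  bin a (suc b) ℕ.* (a ! ℕ.* suc b !)         ≡⟨ r b (bin a (suc b)) (a !) (b !) ⟩
  suc b ℕ.* bin a (suc b) ℕ.* (a ! ℕ.* b !)   ∎)
  where
  open ≡-Reasoning
  l : ∀ a x u v → suc a ℕ.* x ℕ.* (u ℕ.* v) ≡ x ℕ.* ((suc a ℕ.* u) ℕ.* v)
  l = solve-∀ℕ
  r : ∀ b x u v → x ℕ.* (u ℕ.* (suc b ℕ.* v)) ≡ suc b ℕ.* x ℕ.* (u ℕ.* v)
  r = solve-∀ℕ

-- Both sides are the multinomial coefficient (a + b + j)!/(a! b! j!).
bin-swap : ∀ a b j → bin a j ℕ.* bin b (j ℕ.+ a) ≡ bin b j ℕ.* bin a (j ℕ.+ b)
bin-swap a b j = ℕ.*-cancelʳ-≡ _ _ (a ! ℕ.* b ! ℕ.* j !)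
  ⦃ ℕ.m*n≢0 (a ! ℕ.* b !) (j !) ⦃ a ℕ.!* b !≢0 ⦄ ⦃ j ℕ.!≢0 ⦄ ⦄
  (trans (multinomial a b) (trans
    (cong _! (rot a b j))
    (trans (sym (multinomial b a)) (cong (λ z → bin b j ℕ.* bin a (j ℕ.+ b) ℕ.* (z ℕ.* j !)) (ℕ.*-comm (b !) (a !))))))
  where
  open ≡-Reasoning
  rot : ∀ a b j → b ℕ.+ (j ℕ.+ a) ≡ a ℕ.+ (j ℕ.+ b)
  rot = solve-∀ℕ
  regroup : ∀ x y u v w → x ℕ.* y ℕ.* (u ℕ.* v ℕ.* w) ≡ y ℕ.* (v ℕ.* (x ℕ.* (u ℕ.* w)))
  regroup = solve-∀ℕ
  multinomial : ∀ a b → bin a j ℕ.* bin b (j ℕ.+ a) ℕ.* (a ! ℕ.* b ! ℕ.* j !) ≡ (b ℕ.+ (j ℕ.+ a)) !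
  multinomial a b = begin
    bin a j ℕ.* bin b (j ℕ.+ a) ℕ.* (a ! ℕ.* b ! ℕ.* j !)
      ≡⟨ regroup (bin a j) _ (a !) (b !) (j !) ⟩
    bin b (j ℕ.+ a) ℕ.* (b ! ℕ.* (bin a j ℕ.* (a ! ℕ.* j !)))
      ≡⟨ cong (λ z → bin b (j ℕ.+ a) ℕ.* (b ! ℕ.* z)) (trans (bin-! a j) (cong _! (ℕ.+-comm a j))) ⟩
    bin b (j ℕ.+ a) ℕ.* (b ! ℕ.* (j ℕ.+ a) !)
      ≡⟨ bin-! b (j ℕ.+ a) ⟩
    (b ℕ.+ (j ℕ.+ a)) ! ∎

-- From x^j/j! · x^a/a! = C(a+j, a) x^(a+j)/(a+j)!. Likewise `π` comes from p_a/a! = x^a/a! -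
-- p_(a-1)/(a-1)!.
ε : ℕ → Seq → Seq
ε a ρ j = + bin a j * ρ (j ℕ.+ a)

π : ℕ → Seq → Seq
π zero    ρ j = ρ j
π (suc a) ρ j = ε (suc a) ρ j - π a ρ j

ε-cong : ∀ a {ρ σ} → ρ ≗ σ → ε a ρ ≗ ε a σ
ε-cong a h j = cong (+ bin a j *_) (h (j ℕ.+ a))

π-cong : ∀ a {ρ σ} → ρ ≗ σ → π a ρ ≗ π a σ
π-cong zero    h j = h j
π-cong (suc a) h j = cong₂ _-_ (ε-cong (suc a) h j) (π-cong a h j)

ε-comm : ∀ a b ρ → ε a (ε b ρ) ≗ ε b (ε a ρ)
ε-comm a b ρ j = begin
  + bin a j * (+ bin b (j ℕ.+ a) * ρ (j ℕ.+ a ℕ.+ b))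
    ≡⟨ sym (*-assoc (+ bin a j) (+ bin b (j ℕ.+ a)) _) ⟩
  + bin a j * + bin b (j ℕ.+ a) * ρ (j ℕ.+ a ℕ.+ b)
    ≡⟨ cong₂ (λ x n → x * ρ n)
         (trans (sym (pos-* (bin a j) (bin b (j ℕ.+ a))))
           (trans (cong +_ (bin-swap a b j)) (pos-* (bin b j) (bin a (j ℕ.+ b)))))
         (ex j a b) ⟩
  + bin b j * + bin a (j ℕ.+ b) * ρ (j ℕ.+ b ℕ.+ a)
    ≡⟨ *-assoc (+ bin b j) (+ bin a (j ℕ.+ b)) _ ⟩
  + bin b j * (+ bin a (j ℕ.+ b) * ρ (j ℕ.+ b ℕ.+ a)) ∎
  where
  open ≡-Reasoning
  ex : ∀ j a b → j ℕ.+ a ℕ.+ b ≡ j ℕ.+ b ℕ.+ a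
  ex = solve-∀ℕ

π-ε-comm : ∀ a b ρ → π a (ε b ρ) ≗ ε b (π a ρ)
π-ε-comm zero    b ρ j = refl
π-ε-comm (suc a) b ρ j = trans
  (cong₂ _-_ (ε-comm (suc a) b ρ j) (π-ε-comm a b ρ j))
  (sym (distrib (+ bin b j) _ _))
  where
  distrib : ∀ x y z → x * (y - z) ≡ x * y - x * z
  distrib = solve-∀

π-sub : ∀ a ρ σ j → π a (λ i → ρ i - σ i) j ≡ π a ρ j - π a σ j
π-sub zero    ρ σ j = refl
π-sub (suc a) ρ σ j = trans (cong (_-_ (ε (suc a) (λ i → ρ i - σ i) j)) (π-sub a ρ σ j))
                            (alg (+ bin (suc a) j) _ _ (π a ρ j) (π a σ j))
  where
  alg : ∀ k x y u v → k * (x - y) - (u - v) ≡ (k * x - u) - (k * y - v)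
  alg = solve-∀

-- Both orders multiply by the same polynomial. This makes the count independent of the order of the
-- blocks, so that any two parts can be brought to the front.
π-comm : ∀ a b ρ → π a (π b ρ) ≗ π b (π a ρ)
π-comm a zero    ρ j = refl
π-comm a (suc b) ρ j = trans (π-sub a (ε (suc b) ρ) (π b ρ) j)
  (cong₂ _-_ (π-ε-comm a (suc b) ρ j) (π-comm a b ρ j))

-- Absolutely monotone sequences

Δ : Seq → Seq
Δ f j = f (suc j) - f j

-- All differences of order at most `k` are nonnegative; bounding the order makes induction on it
-- possible.
Monotone : ℕ → Seq → Set
Monotone zero    f = ∀ j → 0ℤ ≤ f j
Monotone (suc k) f = (∀ j → 0ℤ ≤ f j) × Monotone k (Δ f)

AbsolutelyMonotone : Seq → Set
AbsolutelyMonotone f = ∀ k → Monotone k f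

+-nonneg : ∀ {i j} → 0ℤ ≤ i → 0ℤ ≤ j → 0ℤ ≤ i + j
+-nonneg p q = +-mono-≤ p q

*-nonneg : ∀ {i j} → 0ℤ ≤ i → 0ℤ ≤ j → 0ℤ ≤ i * j
*-nonneg {+ m} {+ n} _ _ = subst (0ℤ ≤_) (pos-* m n) (+≤+ ℕ.z≤n)

Monotone-resp : ∀ k {f g} → f ≗ g → Monotone k f → Monotone k g
Monotone-resp zero    e h j = subst (0ℤ ≤_) (e j) (h j)
Monotone-resp (suc k) e (h , h′) =
  (λ j → subst (0ℤ ≤_) (e j) (h j)) , Monotone-resp k (λ j → cong₂ _-_ (e (suc j)) (e j)) h′

Monotone-pred : ∀ k {f} → Monotone (suc k) f → Monotone k f
Monotone-pred zero    (h , _)  = h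
Monotone-pred (suc k) (h , h′) = h , Monotone-pred k h′

Monotone-shift : ∀ k {f} → Monotone k f → Monotone k (f ∘ suc)
Monotone-shift zero    h        = h ∘ suc
Monotone-shift (suc k) (h , h′) = h ∘ suc , Monotone-shift k h′

Monotone-shiftBy : ∀ k a {f} → Monotone k f → Monotone k (λ j → f (j ℕ.+ a))
Monotone-shiftBy k zero    {f} h = Monotone-resp k (λ j → cong f (sym (ℕ.+-identityʳ j))) h
Monotone-shiftBy k (suc a) {f} h =
  Monotone-resp k (λ j → cong f (sym (ℕ.+-suc j a))) (Monotone-shiftBy k a (Monotone-shift k h))

Monotone-+ : ∀ k {f g} → Monotone k f → Monotone k g → Monotone k (λ j → f j + g j)
Monotone-+ zero    hf hg j = +-nonneg (hf j) (hg j)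
Monotone-+ (suc k) {f} {g} (hf , hf′) (hg , hg′) =
  (λ j → +-nonneg (hf j) (hg j)) ,
  Monotone-resp k (λ j → alg (f (suc j)) (f j) (g (suc j)) (g j)) (Monotone-+ k hf′ hg′)
  where
  alg : ∀ a b c d → (a - b) + (c - d) ≡ (a + c) - (b + d)
  alg = solve-∀

-- The discrete Leibniz rule: Δ(fg)(j) = f(j+1) Δg(j) + Δf(j) g(j).
Monotone-* : ∀ k {f g} → Monotone k f → Monotone k g → Monotone k (λ j → f j * g j)
Monotone-* zero    hf hg j = *-nonneg (hf j) (hg j)
Monotone-* (suc k) {f} {g} hf hg =
  (λ j → *-nonneg (proj₁ hf j) (proj₁ hg j)) ,
  Monotone-resp k (λ j → alg (f (suc j)) (f j) (g (suc j)) (g j))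
    (Monotone-+ k (Monotone-* k (Monotone-shift k (Monotone-pred k hf)) (proj₂ hg))
                  (Monotone-* k (proj₂ hf) (Monotone-pred k hg)))
  where
  alg : ∀ a b c d → a * (c - d) + (a - b) * d ≡ a * c - b * d
  alg = solve-∀

Monotone-zero : ∀ k → Monotone k (λ _ → 0ℤ)
Monotone-zero zero    _ = ≤-refl
Monotone-zero (suc k) = (λ _ → ≤-refl) , Monotone-zero k

AM-one : AbsolutelyMonotone (λ _ → 1ℤ)
AM-one zero    _ = +≤+ ℕ.z≤n
AM-one (suc k) = (λ _ → +≤+ ℕ.z≤n) , Monotone-zero k

-- By Pascal's rule the difference of `bin (suc a)` is `bin a` shifted by one.
AM-bin : ∀ a → AbsolutelyMonotone (λ j → + bin a j)
AM-bin zero    = AM-one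
AM-bin (suc a) zero    _ = +≤+ ℕ.z≤n
AM-bin (suc a) (suc k) = (λ _ → +≤+ ℕ.z≤n) ,
  Monotone-resp k (λ j → trans (alg (+ bin a (suc j)) (+ bin (suc a) j))
                               (cong (_- + bin (suc a) j) (sym (pos-+ (bin a (suc j)) (bin (suc a) j)))))
    (Monotone-shift k (AM-bin a k))
  where
  alg : ∀ x y → x ≡ (x + y) - y
  alg = solve-∀

-- This is C(a+j, a+1), that is, `bin (suc a)` delayed by one step with a 0 in front; its difference
-- sequence is `bin a`.
binDiff : ℕ → Seq
binDiff a j = + bin (suc a) j - + bin a j

binDiff-zero : ∀ a → binDiff a 0 ≡ 0ℤ
binDiff-zero a = cong (λ x → 1ℤ - + x) (bin-zeroʳ a)

binDiff-suc : ∀ a j → binDiff a (suc j) ≡ + bin (suc a) j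
binDiff-suc a j = trans (cong (_- + bin a (suc j)) (pos-+ (bin a (suc j)) (bin (suc a) j)))
                        (alg (+ bin a (suc j)) (+ bin (suc a) j))
  where
  alg : ∀ x y → (x + y) - x ≡ y
  alg = solve-∀

AM-binDiff : ∀ a → AbsolutelyMonotone (binDiff a)
AM-binDiff a = am
  where
  nonneg : ∀ j → 0ℤ ≤ binDiff a j
  nonneg zero    = ≤-reflexive (sym (binDiff-zero a))
  nonneg (suc j) = subst (0ℤ ≤_) (sym (binDiff-suc a j)) (+≤+ ℕ.z≤n)
  alg : ∀ x y → y ≡ x - (x - y)
  alg = solve-∀
  am : AbsolutelyMonotone (binDiff a)
  am zero    = nonneg
  am (suc k) = nonneg , Monotone-resp k
    (λ j → trans (alg (+ bin (suc a) j) (+ bin a j)) (cong (_- binDiff a j) (sym (binDiff-suc a j))))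
    (AM-bin a k)

-- Multiplication by x^(a+1)/(a+1)! - x^a/a!, split as in the Leibniz rule into `binDiff a` times a
-- shift of ρ and `bin a` times a shift of Δρ.
AM-ε-diff : ∀ a {ρ} → AbsolutelyMonotone ρ → AbsolutelyMonotone (λ j → ε (suc a) ρ j - ε a ρ j)
AM-ε-diff a {ρ} h k = Monotone-resp k eq
  (Monotone-+ k (Monotone-* k (AM-binDiff a k) (Monotone-shiftBy k (suc a) (h k)))
                (Monotone-* k (AM-bin a k) (Monotone-shiftBy k a (proj₂ (h (suc k))))))
  where
  alg : ∀ x y u v → (x - y) * u + y * (u - v) ≡ x * u - y * v
  alg = solve-∀
  eq : ∀ j → binDiff a j * ρ (j ℕ.+ suc a) + + bin a j * Δ ρ (j ℕ.+ a) ≡ ε (suc a) ρ j - ε a ρ j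
  eq j = trans (cong (λ n → binDiff a j * ρ (j ℕ.+ suc a) + + bin a j * (ρ n - ρ (j ℕ.+ a))) (sym (ℕ.+-suc j a)))
               (alg (+ bin (suc a) j) (+ bin a j) (ρ (j ℕ.+ suc a)) (ρ (j ℕ.+ a)))

-- Two unfoldings give ε (a+2) - ε (a+1) + π a, so the alternating sum is taken in pairs and the
-- induction goes in steps of two.
AM-π : ∀ a {ρ} → AbsolutelyMonotone ρ → AbsolutelyMonotone (π a ρ)
AM-π zero h = h
AM-π (suc zero) {ρ} h k = Monotone-resp k (λ j → cong (_-_ (ε 1 ρ j)) (ε₀ j)) (AM-ε-diff 0 h k)
  where
  ε₀ : ε 0 ρ ≗ ρ
  ε₀ j = trans (*-identityˡ _) (cong ρ (ℕ.+-identityʳ j))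
AM-π (suc (suc a)) {ρ} h k = Monotone-resp k (λ j → alg (ε (suc (suc a)) ρ j) (ε (suc a) ρ j) (π a ρ j))
  (Monotone-+ k (AM-ε-diff (suc a) h k) (AM-π a h k))
  where
  alg : ∀ x y z → (x - y) + z ≡ x - (y - z)
  alg = solve-∀

-- The second backward difference at index 1, where ρ is continued by 0 to negative indices. At
-- index 0 this difference is ρ 0, and from index 2 on it is an ordinary second difference, so
-- absolute monotonicity covers the other indices.
Doubling : Seq → Set
Doubling ρ = 0ℤ ≤ ρ 1 - ρ 0 - ρ 0

bin-oneʳ : ∀ a → bin a 1 ≡ suc a
bin-oneʳ zero    = refl
bin-oneʳ (suc a) = trans (cong (ℕ._+ 1) (bin-oneʳ a)) (ℕ.+-comm (suc a) 1)

-- Steps of two again: what two unfoldings add is a nonnegative combination of a value, a first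
-- difference and a second difference of ρ.
Doubling-π : ∀ a {ρ} → AbsolutelyMonotone ρ → Doubling (π (suc a) ρ)
Doubling-π zero {ρ} h = subst (0ℤ ≤_) (alg (ρ 0) (ρ 1) (ρ 2))
  (+-nonneg (*-nonneg {+ 2} (+≤+ ℕ.z≤n) (proj₁ (proj₂ (proj₂ (h 3))) 0)) (proj₁ (h 1) 1))
  where
  alg : ∀ x y z → + 2 * ((z - y) - (y - x)) + y ≡
    (+ 2 * z - y) - (1ℤ * y - x) - (1ℤ * y - x)
  alg = solve-∀
Doubling-π (suc zero) {ρ} h = subst (0ℤ ≤_) (alg (ρ 0) (ρ 1) (ρ 2) (ρ 3))
  (+-nonneg (*-nonneg {+ 3} (+≤+ ℕ.z≤n) (proj₁ (proj₂ (proj₂ (h 3))) 1))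
            (*-nonneg {+ 2} (+≤+ ℕ.z≤n) (+-nonneg (proj₁ (proj₂ (h 2)) 1) (proj₁ (proj₂ (h 2)) 0))))
  where
  alg : ∀ x y z w → + 3 * ((w - z) - (z - y)) + + 2 * ((z - y) + (y - x)) ≡
    (+ 3 * w - (+ 2 * z - y)) - (1ℤ * z - (1ℤ * y - x)) - (1ℤ * z - (1ℤ * y - x))
  alg = solve-∀
Doubling-π (suc (suc a)) {ρ} h = subst (0ℤ ≤_) eq
  (+-nonneg (+-nonneg (+-nonneg (*-nonneg {+ (1 ℕ.+ c)} (+≤+ ℕ.z≤n) (proj₁ (proj₂ (h 2)) (suc c)))
    (proj₁ (proj₂ (proj₂ (h 3))) c)) (proj₁ (h 1) c)) (Doubling-π a h))
  where
  c = suc (suc a)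
  alg : ∀ c x y z p q →
    c * (z - y) + ((z - y) - (y - x)) + x + (p - q - q) ≡
    ((+ 1 + c) * z - (c * y - p)) - (1ℤ * y - (1ℤ * x - q)) - (1ℤ * y - (1ℤ * x - q))
  alg = solve-∀
  eq : _ ≡ _
  eq = trans (alg (+ (1 ℕ.+ c)) (ρ c) (ρ (suc c)) (ρ (2 ℕ.+ c)) (π (suc a) ρ 1) (π (suc a) ρ 0))
    (cong₂ (λ u v → (+ u * ρ (2 ℕ.+ c) - (+ v * ρ (1 ℕ.+ c) - π (suc a) ρ 1)) -
                     π (suc c) ρ 0 - π (suc c) ρ 0)
       (sym (bin-oneʳ (suc c))) (sym (bin-oneʳ c)))

-- Two blocks

-- A grid is the coefficient array of a power series in t and v. Up to index shifts, schur, δ and σ multiply by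
-- s₂ + s₂₁ = t² + tv + v² + t²v + tv², by 1 - t - v and by (1 + t)(1 + v).
Grid : Set
Grid = ℕ → ℕ → ℤ

schur : Grid → Grid
schur F i j = F i (2 ℕ.+ j) + F (1 ℕ.+ i) (1 ℕ.+ j) + F (2 ℕ.+ i) j + F i (1 ℕ.+ j) + F (1 ℕ.+ i) j

δ : Grid → Grid
δ F i j = F (1 ℕ.+ i) (1 ℕ.+ j) - F i (1 ℕ.+ j) - F (1 ℕ.+ i) j

σ : Grid → Grid
σ F i j = F (1 ℕ.+ i) (1 ℕ.+ j) + F i (1 ℕ.+ j) + F (1 ℕ.+ i) j + F i j

-- (1 + t)(1 + v)(1 - t - v) = 1 - s₂ - s₂₁.
schur-rec : ∀ F y → (∀ i j → σ F i j ≡ y i j) → ∀ i j → F (2 ℕ.+ i) (2 ℕ.+ j) ≡ schur F i j + δ y i j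
schur-rec F y h i j = trans
  (alg (F (2 ℕ.+ i) (2 ℕ.+ j)) (F (1 ℕ.+ i) (2 ℕ.+ j)) (F (2 ℕ.+ i) (1 ℕ.+ j)) (F (1 ℕ.+ i) (1 ℕ.+ j))
       (F i (2 ℕ.+ j)) (F i (1 ℕ.+ j)) (F (2 ℕ.+ i) j) (F (1 ℕ.+ i) j))
  (cong₂ (λ u v → schur F i j + (u - v)) (cong₂ _-_ (h (1 ℕ.+ i) (1 ℕ.+ j)) (h i (1 ℕ.+ j))) (h (1 ℕ.+ i) j))
  where
  alg : ∀ a b c d e f g k → a ≡ e + d + g + f + k + ((a + b + c + d) - (b + e + d + f) - (c + d + g + k))
  alg = solve-∀

-- Induction on both indices. Entries with small second index enter the recurrence only through sums
-- F (i+1) j + F i j, so for j < 2 + k only these sums have to be nonnegative. This leaves room for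
-- a boundary line whose signs alternate.
closure : ∀ k (F Y : Grid) →
  (∀ i j → F i j ≡ - F j i) →
  (∀ i j → F (2 ℕ.+ i) (2 ℕ.+ j) ≡ schur F i j + Y i j) →
  (∀ i j → j ℕ.≤ i → j ℕ.< 2 ℕ.+ k → 0ℤ ≤ F (suc i) j + F i j) →
  (∀ i j → j ℕ.< i → k ℕ.≤ j → 0ℤ ≤ Y i j) →
  ∀ i j → j ℕ.≤ i → 2 ℕ.+ k ℕ.≤ j → 0ℤ ≤ F i j
closure k F Y anti rec low Y≥0 = go
  where
  diag : ∀ i → F i i ≡ 0ℤ
  diag i = self-neg (anti i i)
    where
    self-neg : ∀ {x} → x ≡ - x → x ≡ 0ℤ
    self-neg {+ zero}    _  = refl
    self-neg {+ suc n}   ()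
    self-neg { -[1+ n ]} ()

  P : ℕ → ℕ → Set
  P i j = j ℕ.≤ i → 2 ℕ.+ k ℕ.≤ j → 0ℤ ≤ F i j

  rows : ∀ i j → j ℕ.≤ i → P (suc i) j → P i j → 0ℤ ≤ F (suc i) j + F i j
  rows i j j≤i p q with j ℕ.<? 2 ℕ.+ k
  ... | yes j<k = low i j j≤i j<k
  ... | no  j≮k = +-nonneg (p (ℕ.m≤n⇒m≤1+n j≤i) (ℕ.≮⇒≥ j≮k)) (q j≤i (ℕ.≮⇒≥ j≮k))

  step : ∀ i j → P i (2 ℕ.+ j) → P (1 ℕ.+ i) (1 ℕ.+ j) → P i (1 ℕ.+ j) → P (2 ℕ.+ i) j → P (1 ℕ.+ i) j →
    P (2 ℕ.+ i) (2 ℕ.+ j)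
  step i j p₁ p₂ p₃ p₄ p₅ (ℕ.s≤s (ℕ.s≤s j≤i)) (ℕ.s≤s (ℕ.s≤s k≤j)) with ℕ.m≤n⇒m<n∨m≡n j≤i
  ... | inj₂ refl = ≤-reflexive (sym (diag (2 ℕ.+ i)))
  ... | inj₁ j<i with ℕ.m≤n⇒m<n∨m≡n j<i
  ...   | inj₁ 2+j≤i = subst (0ℤ ≤_)
    (sym (trans (rec i j) (alg (F i (2 ℕ.+ j)) (F (1 ℕ.+ i) (1 ℕ.+ j)) (F (2 ℕ.+ i) j) (F i (1 ℕ.+ j)) (F (1 ℕ.+ i) j) (Y i j))))
    (+-nonneg (+-nonneg (+-nonneg
      (p₁ 2+j≤i (ℕ.s≤s (ℕ.s≤s k≤j)))
      (rows i (1 ℕ.+ j) j<i p₂ p₃))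
      (rows (1 ℕ.+ i) j (ℕ.m≤n⇒m≤1+n j≤i) p₄ p₅))
      (Y≥0 i j j<i k≤j))
    where
    alg : ∀ a b c d e y → a + b + c + d + e + y ≡ a + (b + d) + (c + e) + y
    alg = solve-∀
  -- Here i = j + 1: the terms for t² and tv cancel by antisymmetry and the one for t²v lies on the diagonal.
  ...   | inj₂ refl = subst (0ℤ ≤_) (sym (trans (rec i j)
      (trans (cong₂ (λ u v → u + F (1 ℕ.+ i) i + F (2 ℕ.+ i) j + v + F (1 ℕ.+ i) j + Y i j)
                    (anti i (1 ℕ.+ i)) (diag i))
             (alg (F (1 ℕ.+ i) i) (F (2 ℕ.+ i) j) (F (1 ℕ.+ i) j) (Y i j)))))
    (+-nonneg (rows (1 ℕ.+ i) j (ℕ.m≤n⇒m≤1+n j≤i) p₄ p₅) (Y≥0 i j j<i k≤j))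
    where
    alg : ∀ x c e y → - x + x + c + 0ℤ + e + y ≡ (c + e) + y
    alg = solve-∀

  go : ∀ i j → P i j
  go _ zero _ ()
  go _ (suc zero) _ (ℕ.s≤s ())
  go zero (suc (suc j)) ()
  go (suc zero) (suc (suc j)) (ℕ.s≤s ())
  go (suc (suc i)) (suc (suc j)) = step i j
    (go i (suc (suc j))) (go (suc i) (suc j)) (go i (suc j)) (go (suc (suc i)) j) (go (suc i) j)

-- Four leading zeros stand in for negative indices, so that all recurrences hold without boundary cases.
pad : Seq → Seq
pad f 0 = 0ℤ
pad f 1 = 0ℤ
pad f 2 = 0ℤ
pad f 3 = 0ℤ
pad f (suc (suc (suc (suc n)))) = f n

pad₂ : Grid → Grid
pad₂ f i j = pad (λ a → pad (f a) j) i

pad₂-sym : ∀ {f} → (∀ a b → f a b ≡ f b a) → ∀ i j → pad₂ f i j ≡ pad₂ f j i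
pad₂-sym {f} h = go
  where
  low : ∀ {g : ℕ → ℤ} i → (∀ n → g n ≡ 0ℤ) → 0ℤ ≡ pad g i
  low 0 _ = refl
  low 1 _ = refl
  low 2 _ = refl
  low 3 _ = refl
  low (suc (suc (suc (suc i)))) h = sym (h i)
  go : ∀ i j → pad₂ f i j ≡ pad₂ f j i
  go 0 j = low j λ _ → refl
  go 1 j = low j λ _ → refl
  go 2 j = low j λ _ → refl
  go 3 j = low j λ _ → refl
  go (suc (suc (suc (suc i)))) 0 = refl
  go (suc (suc (suc (suc i)))) 1 = refl
  go (suc (suc (suc (suc i)))) 2 = refl
  go (suc (suc (suc (suc i)))) 3 = refl
  go (suc (suc (suc (suc i)))) (suc (suc (suc (suc j)))) = h i j

-- Multiplication of the generating function by 1 - z, the value at index -1 being 0.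
∇ : Seq → Seq
∇ μ zero    = μ 0
∇ μ (suc n) = μ (suc n) - μ n

-- The coefficients of Σ μ_n (t + v)^n, padded.
binGrid : Seq → Grid
binGrid μ = pad₂ (λ a b → + bin b a * μ (a ℕ.+ b))

δ-cong : ∀ {F G : Grid} → (∀ i j → F i j ≡ G i j) → ∀ i j → δ F i j ≡ δ G i j
δ-cong h i j = cong₂ _-_ (cong₂ _-_ (h _ _) (h _ _)) (h _ _)

-- On a series in z = t + v, multiplication by 1 - t - v is multiplication by 1 - z.
δ-binGrid : ∀ μ i j → δ (binGrid μ) i j ≡ binGrid (∇ μ) (1 ℕ.+ i) (1 ℕ.+ j)
δ-binGrid μ 0 j = refl
δ-binGrid μ 1 j = refl
δ-binGrid μ 2 j = refl
δ-binGrid μ 3 0 = refl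
δ-binGrid μ 3 1 = refl
δ-binGrid μ 3 2 = refl
δ-binGrid μ 3 3 = alg (μ 0)
  where
  alg : ∀ x → 1ℤ * x - 0ℤ - 0ℤ ≡ 1ℤ * x
  alg = solve-∀
δ-binGrid μ 3 (suc (suc (suc (suc b)))) = trans
  (cong (λ u → 1ℤ * μ (suc b) - 0ℤ - + u * μ b) (bin-zeroʳ b)) (alg (μ (suc b)) (μ b))
  where
  alg : ∀ x y → 1ℤ * x - 0ℤ - 1ℤ * y ≡ 1ℤ * (x - y)
  alg = solve-∀
δ-binGrid μ (suc (suc (suc (suc a)))) 0 = refl
δ-binGrid μ (suc (suc (suc (suc a)))) 1 = refl
δ-binGrid μ (suc (suc (suc (suc a)))) 2 = refl
δ-binGrid μ (suc (suc (suc (suc a)))) 3 = alg (μ (suc a ℕ.+ 0)) (μ (a ℕ.+ 0))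
  where
  alg : ∀ x y → 1ℤ * x - 1ℤ * y - 0ℤ ≡ 1ℤ * (x - y)
  alg = solve-∀
δ-binGrid μ (suc (suc (suc (suc a)))) (suc (suc (suc (suc b)))) = trans
  (cong₂ (λ u n → u * μ (suc a ℕ.+ suc b) - + x * μ (a ℕ.+ suc b) - + y * μ n)
         (pos-+ y x) (sym (ℕ.+-suc a b)))
  (trans (alg (+ x) (+ y) (μ (suc a ℕ.+ suc b)) (μ (a ℕ.+ suc b)))
         (cong (_* (μ (suc a ℕ.+ suc b) - μ (a ℕ.+ suc b))) (sym (pos-+ y x))))
  where
  x = bin (suc b) a
  y = bin b (suc a)
  alg : ∀ x y u v → (y + x) * u - x * v - y * v ≡ (y + x) * (u - v)
  alg = solve-∀

bin-≤ : ∀ {a b} → b ℕ.< a → bin b (suc a) ℕ.≤ bin (suc b) a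
bin-≤ {a} {b} b<a = ℕ.*-cancelˡ-≤ (suc b) (begin
  suc b ℕ.* bin b (suc a) ≤⟨ ℕ.*-monoˡ-≤ (bin b (suc a)) (ℕ.m≤n⇒m≤1+n b<a) ⟩
  suc a ℕ.* bin b (suc a) ≡⟨ sym (bin-absorb b a) ⟩
  suc b ℕ.* bin (suc b) a ∎)
  where open ℕ.≤-Reasoning

-- Both entries have the same total degree and carry the same value of μ, so only binomials of one
-- row of Pascal's triangle are compared. This is the source term in the recurrence for `Y`.
binGrid-≤ : ∀ {μ} → (∀ n → 0ℤ ≤ μ n) → ∀ i j → j ℕ.< i →
  0ℤ ≤ binGrid μ (3 ℕ.+ i) (4 ℕ.+ j) - binGrid μ (4 ℕ.+ i) (3 ℕ.+ j)
binGrid-≤ {μ} h (suc a) zero _ = subst (0ℤ ≤_) (sym (+-identityʳ _)) (*-nonneg {1ℤ} (+≤+ ℕ.z≤n) (h (a ℕ.+ 0)))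
binGrid-≤ {μ} h (suc a) (suc b) (ℕ.s≤s b<a) = subst (0ℤ ≤_)
  (trans (alg (+ bin (suc b) a) (+ bin b (suc a)) (μ (a ℕ.+ suc b)))
    (cong (λ n → + bin (suc b) a * μ (a ℕ.+ suc b) - + bin b (suc a) * μ n) (ℕ.+-suc a b)))
  (*-nonneg (i≤j⇒0≤j-i (+≤+ (bin-≤ b<a))) (h (a ℕ.+ suc b)))
  where
  alg : ∀ x y u → (x - y) * u ≡ x * u - y * u
  alg = solve-∀

module Pair (ρ : Seq) where

  h : Grid
  h a b = π a (π b ρ) 0

  H W Y : Grid
  H = pad₂ h
  -- W (4 + a) (4 + b) = (a + 1) h (a + 1) b - (b + 1) h a (b + 1).
  W i j = (+ i - + 3) * H (1 ℕ.+ i) j - (+ j - + 3) * H i (1 ℕ.+ j)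
  -- Up to index shifts, `Y` is (1 - t - v)(t - v) `H`.
  Y = δ (λ i j → H i (1 ℕ.+ j) - H (1 ℕ.+ i) j)

  H-sym : ∀ i j → H i j ≡ H j i
  H-sym = pad₂-sym (λ a b → π-comm a b ρ 0)

  private
    π-cancel : ∀ a χ j → π (suc a) χ j + π a χ j ≡ ε (suc a) χ j
    π-cancel a χ j = alg (ε (suc a) χ j) (π a χ j)
      where
      alg : ∀ x y → x - y + y ≡ x
      alg = solve-∀

    h-corner : h 0 0 ≡ 1ℤ * ρ 0
    h-corner = sym (*-identityˡ (ρ 0))

    h-sides : ∀ a → h (suc a) 0 + h a 0 ≡ 1ℤ * ρ (suc a ℕ.+ 0)
    h-sides a = trans (π-cancel a ρ 0) (cong (λ n → 1ℤ * ρ n) (sym (ℕ.+-identityʳ (suc a))))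

    h-inner : ∀ a b → h (suc a) (suc b) + h a (suc b) + h (suc a) b + h a b ≡
      + bin (suc b) (suc a) * ρ (suc a ℕ.+ suc b)
    h-inner a b = trans
      (alg (h (suc a) (suc b)) (h a (suc b)) (h (suc a) b) (h a b))
      (trans (cong₂ _+_ (π-cancel a (π (suc b) ρ) 0) (π-cancel a (π b ρ) 0))
      (trans (alg′ (π (suc b) ρ (suc a)) (π b ρ (suc a))) (π-cancel b ρ (suc a))))
      where
      alg : ∀ x y z w → x + y + z + w ≡ (x + y) + (z + w)
      alg = solve-∀
      alg′ : ∀ x y → 1ℤ * x + 1ℤ * y ≡ x + y
      alg′ = solve-∀

  -- Since p_(a+1)/(a+1)! + p_a/a! = x^(a+1)/(a+1)!, multiplying Σ p_a t^a/a! by 1 + t gives e^(xt).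
  -- Hence (1 + t)(1 + v) `H` is L (e^(x(t+v)) R) = Σ ρ_n (t + v)^n.
  σ-H : ∀ i j → σ H i j ≡ binGrid ρ (1 ℕ.+ i) (1 ℕ.+ j)
  σ-H 0 j = refl
  σ-H 1 j = refl
  σ-H 2 j = refl
  σ-H 3 0 = refl
  σ-H 3 1 = refl
  σ-H 3 2 = refl
  σ-H 3 3 = trans (alg (h 0 0)) h-corner
    where
    alg : ∀ x → x + 0ℤ + 0ℤ + 0ℤ ≡ x
    alg = solve-∀
  σ-H 3 (suc (suc (suc (suc b)))) = trans (alg (h 0 (suc b)) (h 0 b)) (π-cancel b ρ 0)
    where
    alg : ∀ x y → x + 0ℤ + y + 0ℤ ≡ x + y
    alg = solve-∀
  σ-H (suc (suc (suc (suc a)))) 0 = refl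
  σ-H (suc (suc (suc (suc a)))) 1 = refl
  σ-H (suc (suc (suc (suc a)))) 2 = refl
  σ-H (suc (suc (suc (suc a)))) 3 = trans (alg (h (suc a) 0) (h a 0)) (h-sides a)
    where
    alg : ∀ x y → x + y + 0ℤ + 0ℤ ≡ x + y
    alg = solve-∀
  σ-H (suc (suc (suc (suc a)))) (suc (suc (suc (suc b)))) = h-inner a b

  private
    -- The t- and v-derivatives of a series in t + v agree; subtracting 2 turns padded indices into
    -- exponents.
    absorb : ∀ i j → (+ i - + 2) * binGrid ρ (2 ℕ.+ i) (1 ℕ.+ j) ≡ (+ j - + 2) * binGrid ρ (1 ℕ.+ i) (2 ℕ.+ j)
    absorb 0 j = sym (*-zeroʳ (+ j - + 2))
    absorb 1 j = sym (*-zeroʳ (+ j - + 2))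
    absorb 2 j = sym (*-zeroʳ (+ j - + 2))
    absorb (suc (suc (suc a))) 0 = *-zeroʳ (+ suc a)
    absorb (suc (suc (suc a))) 1 = *-zeroʳ (+ suc a)
    absorb (suc (suc (suc a))) 2 = *-zeroʳ (+ suc a)
    absorb (suc (suc (suc a))) (suc (suc (suc b))) = trans
      (sym (*-assoc (+ suc a) (+ bin b (suc a)) (ρ (suc a ℕ.+ b))))
      (trans (cong₂ (λ u n → u * ρ n)
          (trans (sym (pos-* (suc a) (bin b (suc a))))
          (trans (cong +_ (sym (bin-absorb b a))) (pos-* (suc b) (bin (suc b) a))))
          (sym (ℕ.+-suc a b)))
        (*-assoc (+ suc b) (+ bin (suc b) a) (ρ (a ℕ.+ suc b))))

  -- (1 + t)(1 + v) H is a series in t + v, hence killed by ∂/∂t - ∂/∂v, and W is the image of H under it.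
  σ-W : ∀ i j → σ W i j ≡ H i (1 ℕ.+ j) - H (1 ℕ.+ i) j
  σ-W i j = trans
    (alg (+ i) (+ j) (H (2 ℕ.+ i) (1 ℕ.+ j)) (H (1 ℕ.+ i) (1 ℕ.+ j)) (H (2 ℕ.+ i) j) (H (1 ℕ.+ i) j)
         (H (1 ℕ.+ i) (2 ℕ.+ j)) (H i (2 ℕ.+ j)) (H i (1 ℕ.+ j)))
    (trans (cong₂ (λ u v → (+ i - + 2) * u - (+ j - + 2) * v + (H i (1 ℕ.+ j) - H (1 ℕ.+ i) j))
                  (σ-H (1 ℕ.+ i) j) (σ-H i (1 ℕ.+ j)))
    (trans (cong (λ u → u - (+ j - + 2) * binGrid ρ (1 ℕ.+ i) (2 ℕ.+ j) + (H i (1 ℕ.+ j) - H (1 ℕ.+ i) j)) (absorb i j))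
           (alg′ ((+ j - + 2) * binGrid ρ (1 ℕ.+ i) (2 ℕ.+ j)) _)))
    where
    alg : ∀ i j a b c d e f g →
      ((+ 1 + i - + 3) * a - (+ 1 + j - + 3) * e) +
      ((i - + 3) * b - (+ 1 + j - + 3) * f) +
      ((+ 1 + i - + 3) * c - (j - + 3) * b) +
      ((i - + 3) * d - (j - + 3) * g) ≡
      (i - + 2) * (a + b + c + d) - (j - + 2) * (e + f + b + g) + (g - d)
    alg = solve-∀
    alg′ : ∀ x y → x - x + y ≡ y
    alg′ = solve-∀

  W-rec : ∀ i j → W (2 ℕ.+ i) (2 ℕ.+ j) ≡ schur W i j + Y i j
  W-rec = schur-rec W _ σ-W

  W-anti : ∀ i j → W i j ≡ - W j i
  W-anti i j = trans (cong₂ (λ u v → (+ i - + 3) * u - (+ j - + 3) * v) (H-sym (1 ℕ.+ i) j) (H-sym i (1 ℕ.+ j)))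
                     (alg ((+ i - + 3) * H j (1 ℕ.+ i)) ((+ j - + 3) * H (1 ℕ.+ j) i))
    where
    alg : ∀ x y → x - y ≡ - (y - x)
    alg = solve-∀

  W-low : ∀ i j → j ℕ.< 4 → W i j ≡ 0ℤ
  W-low i j j<4 = trans (W-anti i j) (cong -_ (low j j<4))
    where
    alg : ∀ x y → x * 0ℤ - y * 0ℤ ≡ 0ℤ
    alg = solve-∀
    alg′ : ∀ x y → 0ℤ * x - y * 0ℤ ≡ 0ℤ
    alg′ = solve-∀
    low : ∀ j → j ℕ.< 4 → W j i ≡ 0ℤ
    low 0 _ = alg (+ 0 - + 3) (+ i - + 3)
    low 1 _ = alg (+ 1 - + 3) (+ i - + 3)
    low 2 _ = alg (+ 2 - + 3) (+ i - + 3)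
    low 3 _ = alg′ (H 4 i) (+ i - + 3)
    low (suc (suc (suc (suc j)))) (ℕ.s≤s (ℕ.s≤s (ℕ.s≤s (ℕ.s≤s ()))))

  Y-anti : ∀ i j → Y i j ≡ - Y j i
  Y-anti i j = trans (cong₂ _-_ (cong₂ _-_ (y-anti (1 ℕ.+ i) (1 ℕ.+ j)) (y-anti i (1 ℕ.+ j))) (y-anti (1 ℕ.+ i) j))
    (alg (y (1 ℕ.+ j) (1 ℕ.+ i)) (y (1 ℕ.+ j) i) (y j (1 ℕ.+ i)))
    where
    y : Grid
    y i j = H i (1 ℕ.+ j) - H (1 ℕ.+ i) j
    y-anti : ∀ i j → y i j ≡ - y j i
    y-anti i j = trans (cong₂ _-_ (H-sym i (1 ℕ.+ j)) (H-sym (1 ℕ.+ i) j)) (neg (H (1 ℕ.+ j) i) (H j (1 ℕ.+ i)))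
      where
      neg : ∀ u v → u - v ≡ - (v - u)
      neg = solve-∀
    alg : ∀ a b c → - a - - b - - c ≡ - (a - c - b)
    alg = solve-∀

  Y-low : ∀ i j → j ℕ.< 2 → Y i j ≡ 0ℤ
  Y-low i 0 _ = Y-anti i 0
  Y-low i 1 _ = Y-anti i 1
  Y-low i (suc (suc j)) (ℕ.s≤s (ℕ.s≤s ()))

  Convex : Set
  Convex = ∀ n → 0ℤ ≤ ∇ (∇ ρ) n

  σ-Y : ∀ i j → σ Y i j ≡ δ (λ i j → binGrid ρ (1 ℕ.+ i) (2 ℕ.+ j) - binGrid ρ (2 ℕ.+ i) (1 ℕ.+ j)) i j
  σ-Y i j = trans
    (alg (y (2 ℕ.+ i) (2 ℕ.+ j)) (y (2 ℕ.+ i) (1 ℕ.+ j)) (y (2 ℕ.+ i) j)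
         (y (1 ℕ.+ i) (2 ℕ.+ j)) (y (1 ℕ.+ i) (1 ℕ.+ j)) (y (1 ℕ.+ i) j)
         (y i (2 ℕ.+ j)) (y i (1 ℕ.+ j)) (y i j))
    (δ-cong σ-y i j)
    where
    y : Grid
    y i j = H i (1 ℕ.+ j) - H (1 ℕ.+ i) j
    alg : ∀ a b c d e f g h k →
      (a - d - b) + (d - g - e) + (b - e - c) + (e - h - f) ≡
      (a + d + b + e) - (d + g + e + h) - (b + e + c + f)
    alg = solve-∀
    alg′ : ∀ a b c d e f g →
      (a - b) + (c - d) + (d - e) + (f - g) ≡ (a + c + d + f) - (b + d + e + g)
    alg′ = solve-∀
    σ-y : ∀ i j → σ y i j ≡ binGrid ρ (1 ℕ.+ i) (2 ℕ.+ j) - binGrid ρ (2 ℕ.+ i) (1 ℕ.+ j)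
    σ-y i j = trans
      (alg′ (H (1 ℕ.+ i) (2 ℕ.+ j)) (H (2 ℕ.+ i) (1 ℕ.+ j)) (H i (2 ℕ.+ j)) (H (1 ℕ.+ i) (1 ℕ.+ j))
            (H (2 ℕ.+ i) j) (H i (1 ℕ.+ j)) (H (1 ℕ.+ i) j))
      (cong₂ _-_ (σ-H i (1 ℕ.+ j)) (σ-H (1 ℕ.+ i) j))

  -- `σ Y` is (t - v)(1 - t - v) Σ ρ_n (t + v)^n; the further factor 1 - t - v from `schur-rec`
  -- turns ρ into `∇ (∇ ρ)`.
  Y-rec : ∀ i j → Y (2 ℕ.+ i) (2 ℕ.+ j) ≡ schur Y i j +
    (binGrid (∇ (∇ ρ)) (3 ℕ.+ i) (4 ℕ.+ j) - binGrid (∇ (∇ ρ)) (4 ℕ.+ i) (3 ℕ.+ j))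
  Y-rec i j = trans (schur-rec Y _ σ-Y i j) (cong (λ u → schur Y i j + u) (trans
    (alg (B (3 ℕ.+ i) (4 ℕ.+ j)) (B (4 ℕ.+ i) (3 ℕ.+ j)) (B (2 ℕ.+ i) (4 ℕ.+ j)) (B (3 ℕ.+ i) (3 ℕ.+ j))
         (B (4 ℕ.+ i) (2 ℕ.+ j)) (B (1 ℕ.+ i) (4 ℕ.+ j)) (B (2 ℕ.+ i) (3 ℕ.+ j)) (B (3 ℕ.+ i) (2 ℕ.+ j))
         (B (4 ℕ.+ i) (1 ℕ.+ j)))
    (cong₂ _-_ (δδ (1 ℕ.+ i) (2 ℕ.+ j)) (δδ (2 ℕ.+ i) (1 ℕ.+ j)))))
    where
    B = binGrid ρ
    δδ : ∀ i j → δ (δ B) i j ≡ binGrid (∇ (∇ ρ)) (2 ℕ.+ i) (2 ℕ.+ j)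
    δδ i j = trans (δ-cong (δ-binGrid ρ) i j) (δ-binGrid (∇ ρ) (1 ℕ.+ i) (1 ℕ.+ j))
    alg : ∀ a b c d e f g h k →
      (a - b - (c - d) - (d - e)) - (c - d - (f - g) - (g - h)) - (d - e - (g - h) - (h - k)) ≡
      (a - c - d - (c - f - g) - (d - g - h)) - (b - d - e - (d - g - h) - (e - h - k))
    alg = solve-∀

  Y≥0 : Convex → ∀ i j → j ℕ.≤ i → 0ℤ ≤ Y i j
  Y≥0 conv i j j≤i with j ℕ.<? 2
  ... | yes j<2 = ≤-reflexive (sym (Y-low i j j<2))
  ... | no  j≮2 = closure 0 Y _ Y-anti Y-rec
    (λ i j _ j<2 → ≤-reflexive (sym (cong₂ _+_ (Y-low (suc i) j j<2) (Y-low i j j<2))))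
    (λ i j j<i _ → binGrid-≤ conv i j j<i) i j j≤i (ℕ.≮⇒≥ j≮2)

  W≥0 : Convex → ∀ i j → j ℕ.≤ i → 2 ℕ.≤ j → 0ℤ ≤ W i j
  W≥0 conv = closure 0 W Y W-anti W-rec
    (λ i j _ j<2 → ≤-reflexive (sym (cong₂ _+_ (W-low (suc i) j (ℕ.≤-trans j<2 2≤4)) (W-low i j (ℕ.≤-trans j<2 2≤4)))))
    (λ i j j<i _ → Y≥0 conv i j (ℕ.<⇒≤ j<i))
    where
    2≤4 : 2 ℕ.≤ 4
    2≤4 = ℕ.s≤s (ℕ.s≤s ℕ.z≤n)

  transfer : ∀ a b → 0ℤ ≤ W (4 ℕ.+ a) (4 ℕ.+ b) → + suc b * h a (suc b) ≤ + suc a * h (suc a) b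
  transfer a b w = 0≤i-j⇒j≤i w

transfer-convex : ∀ {ρ a b} → AbsolutelyMonotone ρ → Doubling ρ → b ℕ.≤ a →
  + suc b * π a (π (suc b) ρ) 0 ≤ + suc a * π (suc a) (π b ρ) 0
transfer-convex {ρ} {a} {b} am db b≤a = transfer a b
  (W≥0 convex (4 ℕ.+ a) (4 ℕ.+ b) (ℕ.+-monoʳ-≤ 4 b≤a) (ℕ.s≤s (ℕ.s≤s ℕ.z≤n)))
  where
  open Pair ρ
  convex : Convex
  convex 0 = am 0 0
  convex 1 = db
  convex (suc (suc n)) = proj₂ (proj₂ (am 2)) n

-- The pair with no further factor

one : Seq
one _ = 1ℤ

sgn : Seq
sgn zero    = 1ℤ
sgn (suc n) = - sgn n

-- For R = 1 the second backward difference at index 1 is -1, so `W≥0` does not apply; instead `Y`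
-- and the first line of `W` are computed explicitly.
module PairOne where
  open Pair one

  s : Seq
  s = pad sgn

  private
    pad-sgn : ∀ i → s (1 ℕ.+ i) + s i ≡ pad (∇ one) (1 ℕ.+ i)
    pad-sgn 0 = refl
    pad-sgn 1 = refl
    pad-sgn 2 = refl
    pad-sgn 3 = refl
    pad-sgn (suc (suc (suc (suc n)))) = +-inverseˡ (sgn n)

    binGrid-∇one : ∀ i j → binGrid (∇ one) i j ≡ pad (∇ one) i * pad (∇ one) j
    binGrid-∇one 0 j = refl
    binGrid-∇one 1 j = refl
    binGrid-∇one 2 j = refl
    binGrid-∇one 3 j = refl
    binGrid-∇one (suc (suc (suc (suc a)))) 0 = sym (*-zeroʳ (∇ one a))
    binGrid-∇one (suc (suc (suc (suc a)))) 1 = sym (*-zeroʳ (∇ one a))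
    binGrid-∇one (suc (suc (suc (suc a)))) 2 = sym (*-zeroʳ (∇ one a))
    binGrid-∇one (suc (suc (suc (suc a)))) 3 = sym (*-zeroʳ (∇ one a))
    binGrid-∇one (suc (suc (suc (suc zero)))) (suc (suc (suc (suc zero)))) = refl
    binGrid-∇one (suc (suc (suc (suc zero)))) (suc (suc (suc (suc (suc b))))) = *-zeroʳ (+ bin (suc b) 0)
    binGrid-∇one (suc (suc (suc (suc (suc a))))) (suc (suc (suc (suc b)))) = *-zeroʳ (+ bin b (suc a))

    X : Grid
    X i j = δ H i j - s (1 ℕ.+ i) * s (1 ℕ.+ j)

    σ-X : ∀ i j → σ X i j ≡ 0ℤ
    σ-X i j = trans
      (alg (H (2 ℕ.+ i) (2 ℕ.+ j)) (H (2 ℕ.+ i) (1 ℕ.+ j)) (H (2 ℕ.+ i) j)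
           (H (1 ℕ.+ i) (2 ℕ.+ j)) (H (1 ℕ.+ i) (1 ℕ.+ j)) (H (1 ℕ.+ i) j)
           (H i (2 ℕ.+ j)) (H i (1 ℕ.+ j)) (H i j)
           (s (2 ℕ.+ i)) (s (1 ℕ.+ i)) (s (2 ℕ.+ j)) (s (1 ℕ.+ j)))
      (trans (cong₂ _-_
        (trans (δ-cong σ-H i j) (trans (δ-binGrid one (1 ℕ.+ i) (1 ℕ.+ j)) (binGrid-∇one (2 ℕ.+ i) (2 ℕ.+ j))))
        (cong₂ _*_ (pad-sgn (1 ℕ.+ i)) (pad-sgn (1 ℕ.+ j))))
        (+-inverseʳ (pad (∇ one) (2 ℕ.+ i) * pad (∇ one) (2 ℕ.+ j))))
      where
      alg : ∀ a b c d e f g h k x y z w →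
        (a - d - b - x * z) + (d - g - e - y * z) + (b - e - c - x * w) + (e - h - f - y * w) ≡
        ((a + d + b + e) - (d + g + e + h) - (b + e + c + f)) - (x + y) * (z + w)
      alg = solve-∀

    -- A grid killed by `σ` is determined by its values at index 0 in either direction, and these
    -- vanish.
    X≡0 : ∀ i j → X i j ≡ 0ℤ
    X≡0 zero    j = refl
    X≡0 (suc i) zero = cong₂ _-_
      (cong₂ _-_ (cong₂ _-_ (H-sym (2 ℕ.+ i) 1) (H-sym (1 ℕ.+ i) 1)) (H-sym (2 ℕ.+ i) 0))
      (*-zeroʳ (s (2 ℕ.+ i)))
    X≡0 (suc i) (suc j) = trans
      (alg (X (suc i) (suc j)) (X i (suc j)) (X (suc i) j) (X i j))
      (cong₂ _-_ (cong₂ _-_ (cong₂ _-_ (σ-X i j) (X≡0 i (suc j))) (X≡0 (suc i) j)) (X≡0 i j))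
      where
      alg : ∀ a b c d → a ≡ (a + b + c + d) - b - c - d
      alg = solve-∀

  -- (1 + t)(1 + v) `H` is 1/(1 - t - v), so (1 - t - v) `H` is 1/((1 + t)(1 + v)).
  δ-H : ∀ i j → δ H i j ≡ s (1 ℕ.+ i) * s (1 ℕ.+ j)
  δ-H i j = i-j≡0⇒i≡j (δ H i j) _ (X≡0 i j)

  Y-eq : ∀ i j → Y i j ≡ s (1 ℕ.+ i) * s (2 ℕ.+ j) - s (2 ℕ.+ i) * s (1 ℕ.+ j)
  Y-eq i j = trans
    (alg (H (1 ℕ.+ i) (2 ℕ.+ j)) (H (2 ℕ.+ i) (1 ℕ.+ j)) (H i (2 ℕ.+ j)) (H (1 ℕ.+ i) (1 ℕ.+ j)) (H (2 ℕ.+ i) j))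
    (cong₂ _-_ (δ-H i (1 ℕ.+ j)) (δ-H (1 ℕ.+ i) j))
    where
    alg : ∀ a b c d e → (a - b) - (c - d) - (d - e) ≡ (a - c - d) - (b - d - e)
    alg = solve-∀

  -- (t - v)/((1 + t)(1 + v)) = t/(1 + t) - v/(1 + v), so all coefficients off the axes vanish.
  Y-inner : ∀ i j → j ℕ.< i → 3 ℕ.≤ j → 0ℤ ≤ Y i j
  Y-inner (suc (suc (suc (suc a)))) (suc (suc (suc b))) _ _ = ≤-reflexive (sym (trans (Y-eq (4 ℕ.+ a) (3 ℕ.+ b))
    (alg (sgn a) (sgn b))))
    where
    alg : ∀ x y → - x * - y - - - x * y ≡ 0ℤ
    alg = solve-∀
  Y-inner (suc (suc (suc zero))) (suc (suc (suc b))) (ℕ.s≤s (ℕ.s≤s (ℕ.s≤s ()))) _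
  Y-inner (suc (suc zero)) (suc (suc (suc b))) (ℕ.s≤s (ℕ.s≤s ())) _
  Y-inner (suc zero) (suc (suc (suc b))) (ℕ.s≤s ()) _
  Y-inner (suc _) (suc (suc zero)) _ (ℕ.s≤s (ℕ.s≤s ()))
  Y-inner (suc _) (suc zero) _ (ℕ.s≤s ())

  W-row : ∀ i → W (2 ℕ.+ i) 4 ≡ W i 4 + s (1 ℕ.+ i)
  W-row i = trans (W-rec i 2) (trans
    (cong₂ (λ u v → W i 4 + W (1 ℕ.+ i) 3 + W (2 ℕ.+ i) 2 + W i 3 + u + v)
      (W-low (1 ℕ.+ i) 2 (ℕ.s≤s (ℕ.s≤s (ℕ.s≤s ℕ.z≤n)))) (Y-eq i 2))
    (trans (cong₂ (λ u v → W i 4 + u + v + W i 3 + 0ℤ + (s (1 ℕ.+ i) * 1ℤ - s (2 ℕ.+ i) * 0ℤ))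
             (W-low (1 ℕ.+ i) 3 ℕ.≤-refl) (W-low (2 ℕ.+ i) 2 (ℕ.s≤s (ℕ.s≤s (ℕ.s≤s ℕ.z≤n)))))
    (trans (cong (λ u → W i 4 + 0ℤ + 0ℤ + u + 0ℤ + (s (1 ℕ.+ i) * 1ℤ - s (2 ℕ.+ i) * 0ℤ)) (W-low i 3 ℕ.≤-refl))
           (alg (W i 4) (s (1 ℕ.+ i)) (s (2 ℕ.+ i))))))
    where
    alg : ∀ w x y → w + 0ℤ + 0ℤ + 0ℤ + 0ℤ + (x * 1ℤ - y * 0ℤ) ≡ w + x
    alg = solve-∀

  -- The entries `W (4 + a) 4` are 0, 1, -1, 2, -2, .... The negative ones belong to single blocks
  -- of odd size a + 1, but adjacent sums are 0 or 1.
  W-row-pair : ∀ a → 0ℤ ≤ W (5 ℕ.+ a) 4 + W (4 ℕ.+ a) 4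
  W-row-pair zero          = +≤+ ℕ.z≤n
  W-row-pair (suc zero)    = +≤+ ℕ.z≤n
  W-row-pair (suc (suc a)) = subst (0ℤ ≤_)
    (sym (trans (cong₂ _+_ (W-row (5 ℕ.+ a)) (W-row (4 ℕ.+ a))) (alg (W (5 ℕ.+ a) 4) (W (4 ℕ.+ a) 4) (sgn a))))
    (W-row-pair a)
    where
    alg : ∀ x y u → (x + - - u) + (y + - u) ≡ x + y
    alg = solve-∀

  W-row-odd : ∀ k → 0ℤ ≤ W (5 ℕ.+ k ℕ.* 2) 4
  W-row-odd zero    = +≤+ ℕ.z≤n
  W-row-odd (suc k) = subst (0ℤ ≤_) (sym (W-row (5 ℕ.+ k ℕ.* 2)))
    (+-nonneg (W-row-odd k) (subst (0ℤ ≤_) (sym (sgn-even k)) (+≤+ ℕ.z≤n)))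
    where
    sgn-even : ∀ k → sgn (2 ℕ.+ k ℕ.* 2) ≡ 1ℤ
    sgn-even zero    = refl
    sgn-even (suc k) = trans (neg-involutive (sgn (2 ℕ.+ k ℕ.* 2))) (sgn-even k)

  W-low-pair : ∀ i j → j ℕ.≤ i → j ℕ.< 5 → 0ℤ ≤ W (suc i) j + W i j
  W-low-pair i j j≤i j<5 with ℕ.m≤n⇒m<n∨m≡n j<5
  ... | inj₁ (ℕ.s≤s j<4) = ≤-reflexive (sym (cong₂ _+_ (W-low (suc i) j j<4) (W-low i j j<4)))
  W-low-pair (suc (suc (suc (suc a)))) j j≤i j<5 | inj₂ refl = W-row-pair a
  W-low-pair (suc (suc (suc zero))) j (ℕ.s≤s (ℕ.s≤s (ℕ.s≤s ()))) j<5 | inj₂ refl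
  W-low-pair (suc (suc zero)) j (ℕ.s≤s (ℕ.s≤s ())) j<5 | inj₂ refl
  W-low-pair (suc zero) j (ℕ.s≤s ()) j<5 | inj₂ refl

  W-inner : ∀ i j → j ℕ.≤ i → 5 ℕ.≤ j → 0ℤ ≤ W i j
  -- The choice k = 3 puts the alternating line j = 4 among those where only adjacent sums matter,
  -- and asks for `Y` only off the axes.
  W-inner = closure 3 W Y W-anti W-rec W-low-pair Y-inner

transfer-one : ∀ {a b} → suc b ℕ.≤ a →
  + (2 ℕ.+ b) * π a (π (2 ℕ.+ b) one) 0 ≤ + suc a * π (suc a) (π (suc b) one) 0
transfer-one {a} {b} b<a = transfer a (suc b) (W-inner _ _ (ℕ.+-monoʳ-≤ 4 b<a) (ℕ.m≤m+n 5 b))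
  where
  open Pair one
  open PairOne

transfer-one-even : ∀ k → + 1 * π (suc (k ℕ.* 2)) (π 1 one) 0 ≤ + (2 ℕ.+ k ℕ.* 2) * π (2 ℕ.+ k ℕ.* 2) one 0
transfer-one-even k = transfer (suc (k ℕ.* 2)) 0 (W-row-odd k)
  where
  open Pair one
  open PairOne

-- The moment formula

-- Here sequences are unnormalized: ψ stands for m ↦ L (x^m R), and trunc t r ψ for the same with p_{t,r} R, where
-- p_{t,r} = Σ_j (-1)^j r(r-1)⋯(r-j+1) x^{r-j}, the sum being cut after the term with x^{t-1}.
trunc : ℕ → ℕ → Seq → Seq
trunc t zero    ψ m = ψ m
trunc t (suc r) ψ m =
  if does (t ℕ.≤? suc r) then ψ (m ℕ.+ suc r) - + suc r * trunc t r ψ m else ψ (m ℕ.+ suc r)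

trunc-< : ∀ {t} r ψ m → r ℕ.< t → trunc t r ψ m ≡ ψ (m ℕ.+ r)
trunc-< zero    ψ m r<t = cong ψ (sym (ℕ.+-identityʳ m))
trunc-< {t} (suc r) ψ m r<t rewrite dec-false (t ℕ.≤? suc r) (ℕ.<⇒≱ r<t) = refl

trunc-≥ : ∀ {t} r ψ m → t ℕ.≤ suc r → trunc t (suc r) ψ m ≡ ψ (m ℕ.+ suc r) - + suc r * trunc t r ψ m
trunc-≥ {t} r ψ m t≤r rewrite dec-true (t ℕ.≤? suc r) t≤r = refl

moments : List ℕ → Seq
moments []       m = + (m !)
moments (c ∷ rs) = trunc 1 c (moments rs)

-- The product rule for ∏ p_c, with p_c′ = c p_{c-1}.
derive : (List ℕ → ℤ) → List ℕ → ℤ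
derive F []           = 0ℤ
derive F (zero ∷ rs)  = derive (F ∘ (zero ∷_)) rs
derive F (suc c ∷ rs) = + suc c * F (c ∷ rs) + derive (F ∘ (suc c ∷_)) rs

derive-linear : ∀ k F G rs → derive (λ rs → F rs - k * G rs) rs ≡ derive F rs - k * derive G rs
derive-linear k F G []           = alg k
  where
  alg : ∀ k → 0ℤ ≡ 0ℤ - k * 0ℤ
  alg = solve-∀
derive-linear k F G (zero ∷ rs)  = derive-linear k _ _ rs
derive-linear k F G (suc c ∷ rs) = trans (cong (λ u → + suc c * (F (c ∷ rs) - k * G (c ∷ rs)) + u) (derive-linear k _ _ rs))
  (alg (+ suc c) k (F (c ∷ rs)) (G (c ∷ rs)) _ _)
  where
  alg : ∀ c k f g x y → c * (f - k * g) + (x - k * y) ≡ (c * f + x) - k * (c * g + y)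
  alg = solve-∀

derive-trunc : ∀ t r (F : List ℕ → Seq) rs m →
  derive (λ rs → trunc t r (F rs) m) rs ≡ trunc t r (λ j → derive (λ rs → F rs j) rs) m
derive-trunc t zero    F rs m = refl
derive-trunc t (suc r) F rs m with does (t ℕ.≤? suc r)
... | true  = trans (derive-linear (+ suc r) _ _ rs)
  (cong (λ u → derive (λ rs → F rs (m ℕ.+ suc r)) rs - + suc r * u) (derive-trunc t r F rs m))
... | false = refl

-- L (x^m R) = L ((x^m R)′) for m > 0, where ψ and χ are the moments of R and R′.
ByParts : Seq → Seq → Set
ByParts ψ χ = ∀ m → ψ (suc m) ≡ + suc m * ψ m + χ (suc m)

byParts-shift : ∀ {ψ χ} → ByParts ψ χ → ∀ m r →
  ψ (m ℕ.+ suc r) ≡ (+ m + + suc r) * ψ (m ℕ.+ r) + χ (m ℕ.+ suc r)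
byParts-shift {ψ} {χ} h m r = trans (cong ψ (ℕ.+-suc m r)) (trans (h (m ℕ.+ r))
  (cong (λ n → + n * ψ (m ℕ.+ r) + χ n) (sym (ℕ.+-suc m r))))

-- The moments of p_c′ R, where p_c′ = c p_(c-1).
lowered : ℕ → Seq → Seq
lowered zero    ψ m = 0ℤ
lowered (suc c) ψ m = + suc c * trunc 1 c ψ m

byParts-trunc : ∀ c {ψ χ} → ByParts ψ χ → ByParts (trunc 1 c ψ) (λ m → lowered c ψ m + trunc 1 c χ m)
byParts-trunc zero {ψ} {χ} h m = trans (h m) (cong (λ u → + suc m * ψ m + u) (sym (+-identityˡ (χ (suc m)))))
byParts-trunc (suc c) {ψ} {χ} h m = begin
  trunc 1 (suc c) ψ (suc m)
    ≡⟨ trunc-≥ c ψ (suc m) (s≤s z≤n) ⟩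
  ψ (suc (m ℕ.+ suc c)) - + suc c * trunc 1 c ψ (suc m)
    ≡⟨ cong₂ (λ u v → u - + suc c * v) (h (m ℕ.+ suc c)) (byParts-trunc c h m) ⟩
  + suc (m ℕ.+ suc c) * a + b - + suc c * (+ suc m * d + (l + e))
    ≡⟨ cong (λ u → u * a + b - + suc c * (+ suc m * d + (l + e))) (pos-+ (suc m) (suc c)) ⟩
  (+ suc m + + suc c) * a + b - + suc c * (+ suc m * d + (l + e))
    ≡⟨ alg (+ suc m) (+ suc c) a b d l e ⟩
  + suc m * (a - + suc c * d) + (+ suc c * (a - l) + (b - + suc c * e))
    ≡⟨ cong (λ u → + suc m * (a - + suc c * d) + (+ suc c * u + (b - + suc c * e))) (a-l c) ⟩
  + suc m * (a - + suc c * d) + (+ suc c * trunc 1 c ψ (suc m) + (b - + suc c * e))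
    ≡⟨ sym (cong₂ (λ u v → + suc m * u + (+ suc c * trunc 1 c ψ (suc m) + v))
         (trunc-≥ c ψ m (s≤s z≤n)) (trunc-≥ c χ (suc m) (s≤s z≤n))) ⟩
  + suc m * trunc 1 (suc c) ψ m + (+ suc c * trunc 1 c ψ (suc m) + trunc 1 (suc c) χ (suc m)) ∎
  where
  open ≡-Reasoning
  a = ψ (m ℕ.+ suc c)
  b = χ (suc (m ℕ.+ suc c))
  d = trunc 1 c ψ m
  l = lowered c ψ (suc m)
  e = trunc 1 c χ (suc m)
  a-l : ∀ c → ψ (m ℕ.+ suc c) - lowered c ψ (suc m) ≡ trunc 1 c ψ (suc m)
  a-l zero    = trans (+-identityʳ _) (cong ψ (trans (ℕ.+-suc m 0) (cong suc (ℕ.+-identityʳ m))))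
  a-l (suc c) = trans (cong (λ n → ψ n - + suc c * trunc 1 c ψ (suc m)) (ℕ.+-suc m (suc c)))
                      (sym (trunc-≥ c ψ (suc m) (s≤s z≤n)))
  alg : ∀ m c a b d l e →
    (m + c) * a + b - c * (m * d + (l + e)) ≡ m * (a - c * d) + (c * (a - l) + (b - c * e))
  alg = solve-∀

derivative : List ℕ → Seq
derivative rs m = derive (λ rs → moments rs m) rs

byParts-moments : ∀ rs → ByParts (moments rs) (derivative rs)
byParts-moments []       m = trans (pos-* (suc m) (m !)) (sym (+-identityʳ _))
byParts-moments (c ∷ rs) m = trans (byParts-trunc c (byParts-moments rs) m)
  (cong (λ u → + suc m * moments (c ∷ rs) m + u) (split c))
  where
  split : ∀ c → lowered c (moments rs) (suc m) + trunc 1 c (derivative rs) (suc m) ≡ derivative (c ∷ rs) (suc m)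
  split zero    = +-identityˡ _
  split (suc c) = cong (λ u → + suc c * trunc 1 c (moments rs) (suc m) + u)
                       (sym (derive-trunc 1 (suc c) moments rs (suc m)))

-- The contribution of putting the t-th value of a block's phase into that block: r positions before
-- sorting, and nothing if t = r, when the value would become a fixed point.
current : ℕ → ℕ → Seq → Seq
current t zero    ψ m = 0ℤ
current t (suc r) ψ m = + suc r * (+ differ t (suc r) * trunc (suc t) r ψ m)

differ-≢ : ∀ {x y} → x ≢ y → differ x y ≡ 1
differ-≢ {x} {y} x≢y rewrite dec-false (x ℕ.≟ y) x≢y = refl

differ-≡ : ∀ x → differ x x ≡ 0
differ-≡ x rewrite dec-true (x ℕ.≟ x) refl = refl

current-≢ : ∀ t r ψ m → t ≢ suc r → current t (suc r) ψ m ≡ + suc r * trunc (suc t) r ψ m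
current-≢ t r ψ m t≢r = cong (λ u → + suc r * u)
  (trans (cong (λ d → + d * trunc (suc t) r ψ m) (differ-≢ t≢r)) (*-identityˡ _))

-- For r > t + 1 the current term cancels the tail in the recursion of p_(t+2,r); for r = t + 1 it
-- is zero and p_(t+2,r) is just x^r.
current-trunc : ∀ t r ψ m → suc t ℕ.≤ r → current (suc t) r ψ m + trunc (suc (suc t)) r ψ m ≡ ψ (m ℕ.+ r)
current-trunc t (suc r) ψ m (s≤s t≤r) with ℕ.m≤n⇒m<n∨m≡n t≤r
... | inj₁ t<r = trans (cong₂ _+_ (current-≢ (suc t) r ψ m (ℕ.<⇒≢ (s≤s t<r))) (trunc-≥ r ψ m (s≤s t<r)))
  (alg (+ suc r * trunc (suc (suc t)) r ψ m) (ψ (m ℕ.+ suc r)))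
  where
  alg : ∀ x y → x + (y - x) ≡ y
  alg = solve-∀
... | inj₂ refl = trans (cong₂ _+_
  (trans (cong (λ d → + suc t * (+ d * trunc (suc (suc t)) t ψ m)) (differ-≡ (suc t))) (*-zeroʳ (+ suc t)))
  (trunc-< (suc t) ψ m ℕ.≤-refl)) (+-identityˡ _)

pred-shift : ∀ m r (ψ : Seq) → + m * ψ (ℕ.pred m ℕ.+ suc r) ≡ + m * ψ (m ℕ.+ r)
pred-shift zero    r ψ = refl
pred-shift (suc m) r ψ = cong (λ n → + suc m * ψ n) (ℕ.+-suc m r)

-- The recurrence for placing one value: the three terms stand for passed blocks, the current block
-- and future blocks. It is integration by parts. When r = t + 1, the term -r x^(r-1) of p_(t+1,r)
-- cancels the forbidden placement; larger r follow by induction.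
trunc-step : ∀ {ψ χ} → ByParts ψ χ → ∀ t r m → 1 ℕ.≤ m ℕ.+ r →
  trunc (suc t) r ψ m ≡
  + m * trunc (suc (suc t)) r ψ (ℕ.pred m) + current (suc t) r ψ m + trunc (suc (suc t)) r χ m
trunc-step {ψ} {χ} h t zero (suc m) _ = trans (h m) (cong (_+ χ (suc m)) (sym (+-identityʳ (+ suc m * ψ m))))
trunc-step {ψ} {χ} h t (suc r) m _ with ℕ.<-cmp (suc r) (suc t)
... | tri< r<t r≢t _ = begin
  trunc (suc t) (suc r) ψ m
    ≡⟨ trunc-< (suc r) ψ m r<t ⟩
  ψ (m ℕ.+ suc r)
    ≡⟨ byParts-shift {ψ} {χ} h m r ⟩
  (+ m + + suc r) * ψ (m ℕ.+ r) + χ (m ℕ.+ suc r)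
    ≡⟨ cong (_+ χ (m ℕ.+ suc r)) (*-distribʳ-+ (ψ (m ℕ.+ r)) (+ m) (+ suc r)) ⟩
  + m * ψ (m ℕ.+ r) + + suc r * ψ (m ℕ.+ r) + χ (m ℕ.+ suc r)
    ≡⟨ sym (cong₂ _+_ (cong₂ _+_
         (trans (cong (λ u → + m * u) (trunc-< (suc r) ψ (ℕ.pred m) (ℕ.m<n⇒m<1+n r<t))) (pred-shift m r ψ))
         (trans (current-≢ (suc t) r ψ m (r≢t ∘ sym)) (cong (λ u → + suc r * u) (trunc-< r ψ m (ℕ.m<n⇒m<1+n (ℕ.<-trans ℕ.≤-refl r<t))))))
         (trunc-< (suc r) χ m (ℕ.m<n⇒m<1+n r<t))) ⟩
  + m * trunc (suc (suc t)) (suc r) ψ (ℕ.pred m) + current (suc t) (suc r) ψ m + trunc (suc (suc t)) (suc r) χ m ∎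
  where
  open ≡-Reasoning
... | tri≈ _ refl _ = begin
  trunc (suc r) (suc r) ψ m
    ≡⟨ trunc-≥ r ψ m ℕ.≤-refl ⟩
  ψ (m ℕ.+ suc r) - + suc r * trunc (suc r) r ψ m
    ≡⟨ cong₂ (λ u v → u - + suc r * v) (byParts-shift {ψ} {χ} h m r) (trunc-< r ψ m ℕ.≤-refl) ⟩
  (+ m + + suc r) * ψ (m ℕ.+ r) + χ (m ℕ.+ suc r) - + suc r * ψ (m ℕ.+ r)
    ≡⟨ alg (+ m) (+ suc r) (ψ (m ℕ.+ r)) (χ (m ℕ.+ suc r)) ⟩
  + m * ψ (m ℕ.+ r) + + suc r * 0ℤ + χ (m ℕ.+ suc r)
    ≡⟨ sym (cong₂ _+_ (cong₂ _+_
         (trans (cong (λ u → + m * u) (trunc-< (suc r) ψ (ℕ.pred m) ℕ.≤-refl)) (pred-shift m r ψ))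
         (cong (λ d → + suc r * (+ d * trunc (suc (suc r)) r ψ m)) (differ-≡ (suc r))))
         (trunc-< (suc r) χ m ℕ.≤-refl)) ⟩
  + m * trunc (suc (suc r)) (suc r) ψ (ℕ.pred m) + current (suc r) (suc r) ψ m + trunc (suc (suc r)) (suc r) χ m ∎
  where
  open ≡-Reasoning
  alg : ∀ m r x y → (m + r) * x + y - r * x ≡ m * x + r * 0ℤ + y
  alg = solve-∀
... | tri> _ r≢t (s≤s t<r) = begin
  trunc (suc t) (suc r) ψ m
    ≡⟨ trunc-≥ r ψ m (ℕ.m≤n⇒m≤1+n t<r) ⟩
  ψ (m ℕ.+ suc r) - + suc r * trunc (suc t) r ψ m
    ≡⟨ cong₂ (λ u v → u - + suc r * v) (byParts-shift {ψ} {χ} h m r)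
         (trunc-step {ψ} {χ} h t r m (ℕ.≤-trans (ℕ.≤-trans (s≤s z≤n) t<r) (ℕ.m≤n+m r m))) ⟩
  (+ m + + suc r) * x + χ (m ℕ.+ suc r) - + suc r * (+ m * p + c + q)
    ≡⟨ alg (+ m) (+ suc r) x (χ (m ℕ.+ suc r)) p c q u ⟩
  + m * x - + m * (+ suc r * p) + + suc r * u + (χ (m ℕ.+ suc r) - + suc r * q) + + suc r * (x - (c + u))
    ≡⟨ cong (λ z → + m * x - + m * (+ suc r * p) + + suc r * u + (χ (m ℕ.+ suc r) - + suc r * q) + + suc r * (x - z))
         (current-trunc t r ψ m t<r) ⟩
  + m * x - + m * (+ suc r * p) + + suc r * u + (χ (m ℕ.+ suc r) - + suc r * q) + + suc r * (x - x)
    ≡⟨ alg′ (+ m) (+ suc r) x (+ m * (+ suc r * p)) (+ suc r * u) (χ (m ℕ.+ suc r) - + suc r * q) ⟩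
  + m * x - + m * (+ suc r * p) + + suc r * u + (χ (m ℕ.+ suc r) - + suc r * q)
    ≡⟨ sym (cong₂ _+_ (cong₂ _+_
         (trans (cong (λ u → + m * u) (trunc-≥ r ψ (ℕ.pred m) (s≤s t<r)))
           (trans (alg″ (+ m) _ (+ suc r * p)) (cong (_- + m * (+ suc r * p)) (pred-shift m r ψ))))
         (current-≢ (suc t) r ψ m (r≢t ∘ sym)))
         (trunc-≥ r χ m (s≤s t<r))) ⟩
  + m * trunc (suc (suc t)) (suc r) ψ (ℕ.pred m) + current (suc t) (suc r) ψ m + trunc (suc (suc t)) (suc r) χ m ∎
  where
  open ≡-Reasoning
  x = ψ (m ℕ.+ r)
  p = trunc (suc (suc t)) r ψ (ℕ.pred m)
  c = current (suc t) r ψ m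
  q = trunc (suc (suc t)) r χ m
  u = trunc (suc (suc t)) r ψ m
  alg : ∀ m r x y p c q u →
    (m + r) * x + y - r * (m * p + c + q) ≡ m * x - m * (r * p) + r * u + (y - r * q) + r * (x - (c + u))
  alg = solve-∀
  alg′ : ∀ m r x a b c → m * x - a + b + c + r * (x - x) ≡ m * x - a + b + c
  alg′ = solve-∀
  alg″ : ∀ m a b → m * (a - b) ≡ m * a - m * b
  alg″ = solve-∀

-- Placements and moments

place-++ : ∀ v F bl bl′ → place v F (bl ++ bl′) ≡ place v (λ b → F (b ++ bl′)) bl ℕ.+ place v (λ b → F (bl ++ b)) bl′
place-++ v F []                 bl′ = refl
place-++ v F ((o , zero)  ∷ bl) bl′ = place-++ v _ bl bl′
place-++ v F ((o , suc r) ∷ bl) bl′ =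
  trans (cong (suc r ℕ.* (differ v (o ℕ.+ suc r) ℕ.* F ((o , r) ∷ bl ++ bl′)) ℕ.+_) (place-++ v _ bl bl′))
        (sym (ℕ.+-assoc (suc r ℕ.* (differ v (o ℕ.+ suc r) ℕ.* F ((o , r) ∷ bl ++ bl′)))
          (place v (λ b → F ((o , suc r) ∷ b ++ bl′)) bl) (place v (λ b → F ((o , suc r) ∷ bl ++ b)) bl′)))

-- All free positions lie before `v`, so no value from `v` on can become a fixed point there.
Passed : ℕ → Block → Set
Passed v (o , r) = o ℕ.+ r ℕ.< v

-- Only the total capacity m of the passed blocks matters; they act like the factor x^m, whose
-- derivative contributes m.
place-passed : ∀ {v F Z} bl → All (Passed v) bl →
  (∀ bl′ → All (Passed v) bl′ → suc (capacity bl′) ≡ capacity bl → + F bl′ ≡ Z) →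
  + place v F bl ≡ + capacity bl * Z
place-passed []                 []      h = refl
place-passed ((o , zero)  ∷ bl) (q ∷ a) h = place-passed bl a (λ bl′ a′ → h ((o , zero) ∷ bl′) (q ∷ a′))
place-passed {v} {F} {Z} ((o , suc r) ∷ bl) (q ∷ a) h = begin
  + (suc r ℕ.* (differ v (o ℕ.+ suc r) ℕ.* F ((o , r) ∷ bl)) ℕ.+ rest)
    ≡⟨ cong (λ d → + (suc r ℕ.* (d ℕ.* F ((o , r) ∷ bl)) ℕ.+ rest)) (differ-≢ (ℕ.>⇒≢ q)) ⟩
  + (suc r ℕ.* (1 ℕ.* F ((o , r) ∷ bl)) ℕ.+ rest)
    ≡⟨ trans (pos-+ (suc r ℕ.* (1 ℕ.* F ((o , r) ∷ bl))) rest)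
             (cong (_+ + rest) (trans (pos-* (suc r) (1 ℕ.* F ((o , r) ∷ bl)))
               (cong (λ z → + suc r * + z) (ℕ.*-identityˡ (F ((o , r) ∷ bl)))))) ⟩
  + suc r * + F ((o , r) ∷ bl) + + rest
    ≡⟨ cong₂ (λ x y → + suc r * x + y)
         (h ((o , r) ∷ bl) (ℕ.≤-trans (s≤s (ℕ.+-monoʳ-≤ o (ℕ.n≤1+n r))) q ∷ a) refl)
         (place-passed bl a (λ bl′ a′ e → h ((o , suc r) ∷ bl′) (q ∷ a′)
           (trans (sym (ℕ.+-suc (suc r) (capacity bl′))) (cong (suc r ℕ.+_) e)))) ⟩
  + suc r * Z + + capacity bl * Z
    ≡⟨ sym (*-distribʳ-+ Z (+ suc r) (+ capacity bl)) ⟩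
  (+ suc r + + capacity bl) * Z
    ≡⟨ cong (_* Z) (sym (pos-+ (suc r) (capacity bl))) ⟩
  + (suc r ℕ.+ capacity bl) * Z ∎
  where
  open ≡-Reasoning
  rest = place v (λ bl′ → F ((o , suc r) ∷ bl′)) bl

-- The blocks with capacities as, starting after position c, of which rs positions are still free.
future : ℕ → List ℕ → List ℕ → List Block
future c (a ∷ as) (r ∷ rs) = (c , r) ∷ future (a ℕ.+ c) as rs
future c _        _        = []

future-toBlocks : ∀ c as → future c as as ≡ toBlocks c as
future-toBlocks c []       = refl
future-toBlocks c (a ∷ as) = cong ((c , a) ∷_) (future-toBlocks (a ℕ.+ c) as)

-- Positions after c exceed `v`, so no placement is forbidden, and choosing a block with its r free
-- positions is the product rule.
place-future : ∀ {v F} {G : List ℕ → ℤ} {as rs} c → Pointwise ℕ._≤_ rs as → v ℕ.≤ c →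
  (∀ rs′ → Pointwise ℕ._≤_ rs′ as → suc (sum rs′) ≡ sum rs → + F (future c as rs′) ≡ G rs′) →
  + place v F (future c as rs) ≡ derive G rs
place-future c [] _ h = refl
place-future {as = a ∷ as} {zero ∷ rs} c (r≤a ∷ le) v≤c h =
  place-future (a ℕ.+ c) le (ℕ.≤-trans v≤c (ℕ.m≤n+m c a)) (λ rs′ le′ → h (zero ∷ rs′) (r≤a ∷ le′))
place-future {v} {F} {G} {a ∷ as} {suc r ∷ rs} c (r≤a ∷ le) v≤c h = begin
  + (suc r ℕ.* (differ v (c ℕ.+ suc r) ℕ.* F ((c , r) ∷ fut)) ℕ.+ rest)
    ≡⟨ cong (λ d → + (suc r ℕ.* (d ℕ.* F ((c , r) ∷ fut)) ℕ.+ rest))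
         (differ-≢ (ℕ.<⇒≢ (ℕ.≤-trans (s≤s v≤c) (ℕ.≤-trans (s≤s (ℕ.m≤m+n c r)) (ℕ.≤-reflexive (sym (ℕ.+-suc c r))))))) ⟩
  + (suc r ℕ.* (1 ℕ.* F ((c , r) ∷ fut)) ℕ.+ rest)
    ≡⟨ trans (pos-+ (suc r ℕ.* (1 ℕ.* F ((c , r) ∷ fut))) rest)
             (cong (_+ + rest) (trans (pos-* (suc r) (1 ℕ.* F ((c , r) ∷ fut)))
               (cong (λ z → + suc r * + z) (ℕ.*-identityˡ (F ((c , r) ∷ fut)))))) ⟩
  + suc r * + F ((c , r) ∷ fut) + + rest
    ≡⟨ cong₂ (λ x y → + suc r * x + y)
         (h (r ∷ rs) (ℕ.≤-trans (ℕ.n≤1+n r) r≤a ∷ le) refl)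
         (place-future (a ℕ.+ c) le (ℕ.≤-trans v≤c (ℕ.m≤n+m c a)) (λ rs′ le′ e → h (suc r ∷ rs′) (r≤a ∷ le′)
           (trans (sym (ℕ.+-suc (suc r) (sum rs′))) (cong (suc r ℕ.+_) e)))) ⟩
  + suc r * G (r ∷ rs) + derive (G ∘ (suc r ∷_)) rs ∎
  where
  open ≡-Reasoning
  fut = future (a ℕ.+ c) as rs
  rest = place v (λ bl′ → F ((c , suc r) ∷ bl′)) fut

sum-mono : ∀ {rs as} → Pointwise ℕ._≤_ rs as → sum rs ℕ.≤ sum as
sum-mono []       = z≤n
sum-mono (p ∷ ps) = ℕ.+-mono-≤ p (sum-mono ps)

differ-+ : ∀ o x y → differ (x ℕ.+ o) (o ℕ.+ y) ≡ differ x y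
differ-+ o x y with x ℕ.≟ y
... | yes refl = trans (cong (λ n → differ n (o ℕ.+ x)) (ℕ.+-comm x o)) (trans (differ-≡ (o ℕ.+ x)) (sym (differ-≡ x)))
... | no  x≢y  = trans (differ-≢ (λ e → x≢y (ℕ.+-cancelˡ-≡ o x y (trans (ℕ.+-comm o x) e)))) (sym (differ-≢ x≢y))

-- The values up to t + o have been placed, the current block is (o , r), and s more values belong to its phase.
fillings-trunc : ∀ as s t o c bl r rs m →
  All (Passed (suc (t ℕ.+ o))) bl → c ≡ s ℕ.+ (t ℕ.+ o) → r ℕ.≤ t ℕ.+ s → Pointwise ℕ._≤_ rs as →
  capacity bl ≡ m → m ℕ.+ r ℕ.+ sum rs ≡ s ℕ.+ sum as →
  + fillings (suc (t ℕ.+ o)) (s ℕ.+ sum as) (bl ++ (o , r) ∷ future c as rs) ≡ trunc (suc t) r (moments rs) m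
fillings-trunc [] zero t o c bl r [] m past ec r≤ [] em eq
  with refl ← ℕ.m+n≡0⇒m≡0 m (ℕ.m+n≡0⇒m≡0 (m ℕ.+ r) eq)
  with refl ← ℕ.m+n≡0⇒n≡0 0 (ℕ.m+n≡0⇒m≡0 r eq)
  = refl
-- The phase of the current block is over and the block joins the passed ones; as r ≤ t, its
-- polynomial is just x^r.
fillings-trunc (a ∷ as) zero t o c bl r (r′ ∷ rs) m past refl r≤ (r′≤a ∷ le) em eq = begin
  + fillings (suc (t ℕ.+ o)) (a ℕ.+ sum as) (bl ++ (o , r) ∷ future c (a ∷ as) (r′ ∷ rs))
    ≡⟨ cong (λ b → + fillings (suc (t ℕ.+ o)) (a ℕ.+ sum as) b) (sym (++-assoc bl ((o , r) ∷ []) _)) ⟩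
  + fillings (suc c) (a ℕ.+ sum as) ((bl ++ (o , r) ∷ []) ++ (c , r′) ∷ future (a ℕ.+ c) as rs)
    ≡⟨ fillings-trunc as a 0 c (a ℕ.+ c) (bl ++ (o , r) ∷ []) r′ rs (m ℕ.+ r)
         (All.++⁺ past (s≤s (ℕ.≤-trans (ℕ.+-monoʳ-≤ o r≤t) (ℕ.≤-reflexive (ℕ.+-comm o t))) ∷ []))
         refl r′≤a le
         (trans (cong sum (map-++ proj₂ bl _)) (trans (sum-++ (map proj₂ bl) _) (cong₂ ℕ._+_ em (ℕ.+-identityʳ r))))
         (trans (ℕ.+-assoc (m ℕ.+ r) r′ (sum rs)) eq) ⟩
  moments (r′ ∷ rs) (m ℕ.+ r)
    ≡⟨ sym (trunc-< r (moments (r′ ∷ rs)) m (s≤s r≤t)) ⟩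
  trunc (suc t) r (moments (r′ ∷ rs)) m ∎
  where
  open ≡-Reasoning
  r≤t : r ℕ.≤ t
  r≤t = ℕ.≤-trans r≤ (ℕ.≤-reflexive (ℕ.+-identityʳ t))
-- The next value goes to a passed, the current or a future block, matching the terms of
-- `trunc-step`.
fillings-trunc as (suc s) t o c bl r rs m past ec r≤ le refl eq = begin
  + place v F (bl ++ (o , r) ∷ fut)
    ≡⟨ cong +_ (place-++ v F bl ((o , r) ∷ fut)) ⟩
  + (place v (λ b → F (b ++ (o , r) ∷ fut)) bl ℕ.+ place v (λ b → F (bl ++ b)) ((o , r) ∷ fut))
    ≡⟨ pos-+ (place v (λ b → F (b ++ (o , r) ∷ fut)) bl) _ ⟩
  + place v (λ b → F (b ++ (o , r) ∷ fut)) bl + + place v (λ b → F (bl ++ b)) ((o , r) ∷ fut)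
    ≡⟨ cong₂ _+_ (place-passed bl past passed) (own r refl) ⟩
  + m * trunc (suc (suc t)) r ψ (ℕ.pred m) + (current (suc t) r ψ m + trunc (suc (suc t)) r (derivative rs) m)
    ≡⟨ sym (+-assoc (+ m * trunc (suc (suc t)) r ψ (ℕ.pred m)) _ _) ⟩
  + m * trunc (suc (suc t)) r ψ (ℕ.pred m) + current (suc t) r ψ m + trunc (suc (suc t)) r (derivative rs) m
    ≡⟨ sym (trunc-step (byParts-moments rs) t r m m+r≥1) ⟩
  trunc (suc t) r ψ m ∎
  where
  open ≡-Reasoning
  v = suc (t ℕ.+ o)
  F = fillings (suc v) (s ℕ.+ sum as)
  fut = future c as rs
  ψ = moments rs

  ec′ : c ≡ s ℕ.+ (suc t ℕ.+ o)
  ec′ = trans ec (sym (ℕ.+-suc s (t ℕ.+ o)))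

  r≤′ : r ℕ.≤ suc t ℕ.+ s
  r≤′ = ℕ.≤-trans r≤ (ℕ.≤-reflexive (ℕ.+-suc t s))

  m+r≥1 : 1 ℕ.≤ m ℕ.+ r
  m+r≥1 = ℕ.+-cancelʳ-≤ (sum rs) 1 (m ℕ.+ r) (ℕ.≤-trans (s≤s (ℕ.≤-trans (sum-mono le) (ℕ.m≤n+m (sum as) s)))
    (ℕ.≤-reflexive (sym eq)))

  passed : ∀ bl′ → All (Passed v) bl′ → suc (capacity bl′) ≡ m →
    + F (bl′ ++ (o , r) ∷ fut) ≡ trunc (suc (suc t)) r ψ (ℕ.pred m)
  passed bl′ past′ e = fillings-trunc as s (suc t) o c bl′ r rs (ℕ.pred m) (All.map ℕ.m<n⇒m<1+n past′) ec′ r≤′ le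
    (cong ℕ.pred e) (ℕ.suc-injective (trans (cong (λ n → suc (n ℕ.+ r ℕ.+ sum rs)) (cong ℕ.pred (sym e)))
      (trans (cong (λ n → n ℕ.+ r ℕ.+ sum rs) e) eq)))

  later : + place v (λ b → F (bl ++ (o , r) ∷ b)) fut ≡ trunc (suc (suc t)) r (derivative rs) m
  later = trans (place-future c le (ℕ.≤-trans (ℕ.m≤n+m v s) (ℕ.≤-reflexive (sym ec′)))
      (λ rs′ le′ e → fillings-trunc as s (suc t) o c bl r rs′ m (All.map ℕ.m<n⇒m<1+n past) ec′ r≤′ le′ refl
        (ℕ.suc-injective (trans (sym (ℕ.+-suc (m ℕ.+ r) (sum rs′))) (trans (cong (m ℕ.+ r ℕ.+_) e) eq)))))
    (derive-trunc (suc (suc t)) r moments rs m)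

  own : ∀ r′ → r ≡ r′ → + place v (λ b → F (bl ++ b)) ((o , r) ∷ fut) ≡
    current (suc t) r ψ m + trunc (suc (suc t)) r (derivative rs) m
  own zero     refl = trans later (sym (+-identityˡ _))
  own (suc r′) refl = begin
    + (suc r′ ℕ.* (differ v (o ℕ.+ suc r′) ℕ.* F (bl ++ (o , r′) ∷ fut)) ℕ.+ rest)
      ≡⟨ cong (λ d → + (suc r′ ℕ.* (d ℕ.* F (bl ++ (o , r′) ∷ fut)) ℕ.+ rest)) (differ-+ o (suc t) (suc r′)) ⟩
    + (suc r′ ℕ.* (differ (suc t) (suc r′) ℕ.* F (bl ++ (o , r′) ∷ fut)) ℕ.+ rest)
      ≡⟨ trans (pos-+ (suc r′ ℕ.* _) rest) (cong (_+ + rest) (trans (pos-* (suc r′) _)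
           (cong (λ z → + suc r′ * z) (pos-* (differ (suc t) (suc r′)) _)))) ⟩
    + suc r′ * (+ differ (suc t) (suc r′) * + F (bl ++ (o , r′) ∷ fut)) + + rest
      ≡⟨ cong₂ (λ x y → + suc r′ * (+ differ (suc t) (suc r′) * x) + y)
           (fillings-trunc as s (suc t) o c bl r′ rs m (All.map ℕ.m<n⇒m<1+n past) ec′
             (ℕ.≤-trans (ℕ.n≤1+n r′) r≤′) le refl
             (ℕ.suc-injective (trans (cong (ℕ._+ sum rs) (sym (ℕ.+-suc m r′))) eq)))
           later ⟩
    current (suc t) r ψ m + trunc (suc (suc t)) r (derivative rs) m ∎
    where rest = place v (λ b → F (bl ++ (o , suc r′) ∷ b)) fut

preimageCount-moments : ∀ n a → IsComposition n a → + preimageCount n a ≡ moments a 0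
preimageCount-moments n a e = trans (cong +_ (preimageCount-fillings n a e)) (go a e)
  where
  refl-≤ : ∀ as → Pointwise ℕ._≤_ as as
  refl-≤ []       = []
  refl-≤ (a ∷ as) = ℕ.≤-refl ∷ refl-≤ as
  go : ∀ a → sum a ≡ n → + fillings 1 n (toBlocks 0 a) ≡ moments a 0
  go []       refl = refl
  go (k ∷ as) refl = trans
    (cong (λ b → + fillings 1 (k ℕ.+ sum as) ((0 , k) ∷ b)) (sym (future-toBlocks (k ℕ.+ 0) as)))
    (fillings-trunc as k 0 0 (k ℕ.+ 0) [] k as 0 [] refl ℕ.≤-refl (refl-≤ as) refl refl)

-- Normalized moments

normalized : List ℕ → Seq
normalized = foldr π one

trunc-π : ∀ K c {ψ ρ} → (∀ j → ψ j ≡ K * + (j !) * ρ j) → ∀ j → trunc 1 c ψ j ≡ K * + (c !) * + (j !) * π c ρ j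
trunc-π K zero    {ψ} {ρ} h j = trans (h j) (cong (λ k → k * + (j !) * ρ j) (sym (*-identityʳ K)))
trunc-π K (suc c) {ψ} {ρ} h j = begin
  trunc 1 (suc c) ψ j
    ≡⟨ trunc-≥ c ψ j (s≤s z≤n) ⟩
  ψ (j ℕ.+ suc c) - + suc c * trunc 1 c ψ j
    ≡⟨ cong₂ (λ x y → x - + suc c * y) (h (j ℕ.+ suc c)) (trunc-π K c h j) ⟩
  K * + ((j ℕ.+ suc c) !) * ρ (j ℕ.+ suc c) - + suc c * (K * + (c !) * + (j !) * π c ρ j)
    ≡⟨ cong (λ x → K * x * ρ (j ℕ.+ suc c) - + suc c * (K * + (c !) * + (j !) * π c ρ j)) fact ⟩
  K * (+ bin (suc c) j * (+ suc c * + (c !) * + (j !))) * ρ (j ℕ.+ suc c) - + suc c * (K * + (c !) * + (j !) * π c ρ j)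
    ≡⟨ alg K (+ bin (suc c) j) (+ suc c) (+ (c !)) (+ (j !)) (ρ (j ℕ.+ suc c)) (π c ρ j) ⟩
  K * (+ suc c * + (c !)) * + (j !) * (+ bin (suc c) j * ρ (j ℕ.+ suc c) - π c ρ j)
    ≡⟨ cong (λ x → K * x * + (j !) * π (suc c) ρ j) (sym (pos-* (suc c) (c !))) ⟩
  K * + (suc c !) * + (j !) * π (suc c) ρ j ∎
  where
  open ≡-Reasoning
  fact : + ((j ℕ.+ suc c) !) ≡ + bin (suc c) j * (+ suc c * + (c !) * + (j !))
  fact = trans (cong +_ (trans (cong _! (ℕ.+-comm j (suc c))) (sym (bin-! (suc c) j))))
    (trans (pos-* (bin (suc c) j) _) (cong (λ x → + bin (suc c) j * x)
      (trans (pos-* (suc c !) (j !)) (cong (_* + (j !)) (pos-* (suc c) (c !))))))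
  alg : ∀ K b c f g x y → K * (b * (c * f * g)) * x - c * (K * f * g * y) ≡ K * (c * f) * g * (b * x - y)
  alg = solve-∀

moments-normalized : ∀ rs j → moments rs j ≡ + product (map _! rs) * + (j !) * normalized rs j
moments-normalized []       j = alg (+ (j !))
  where
  alg : ∀ x → x ≡ 1ℤ * x * 1ℤ
  alg = solve-∀
moments-normalized (c ∷ rs) j = trans (trunc-π (+ product (map _! rs)) c (moments-normalized rs) j)
  (cong (λ k → k * + (j !) * π c (normalized rs) j)
    (trans (sym (pos-* (product (map _! rs)) (c !))) (cong +_ (ℕ.*-comm (product (map _! rs)) (c !)))))

weight : List ℕ → ℤ
weight a = + product (map _! a) * normalized a 0

preimageCount-weight : ∀ n a → IsComposition n a → + preimageCount n a ≡ weight a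
preimageCount-weight n a e = trans (preimageCount-moments n a e) (trans (moments-normalized a 0)
  (cong (_* normalized a 0) (*-identityʳ (+ product (map _! a)))))

-- Majorization

normalized-↭ : ∀ {a b} → a ↭ b → normalized a ≗ normalized b
normalized-↭ ↭.refl         j = refl
normalized-↭ (↭.prep x p)   j = π-cong x (normalized-↭ p) j
normalized-↭ (↭.swap {a} x y p) j = trans (π-comm x y (normalized a) j) (π-cong y (π-cong x (normalized-↭ p)) j)
normalized-↭ (↭.trans p q)  j = trans (normalized-↭ p j) (normalized-↭ q j)

weight-↭ : ∀ {a b} → a ↭ b → weight a ≡ weight b
weight-↭ p = cong₂ (λ m x → + m * x) (product-↭ (map⁺ _! p)) (normalized-↭ p 0)

nonzeroParts-↭ : ∀ {a b} → a ↭ b → nonzeroParts a ≡ nonzeroParts b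
nonzeroParts-↭ ↭.refl                     = refl
nonzeroParts-↭ (↭.prep zero p)            = nonzeroParts-↭ p
nonzeroParts-↭ (↭.prep (suc x) p)         = cong suc (nonzeroParts-↭ p)
nonzeroParts-↭ (↭.swap zero zero p)       = nonzeroParts-↭ p
nonzeroParts-↭ (↭.swap zero (suc y) p)    = cong suc (nonzeroParts-↭ p)
nonzeroParts-↭ (↭.swap (suc x) zero p)    = cong suc (nonzeroParts-↭ p)
nonzeroParts-↭ (↭.swap (suc x) (suc y) p) = cong (suc ∘ suc) (nonzeroParts-↭ p)
nonzeroParts-↭ (↭.trans p q)              = trans (nonzeroParts-↭ p) (nonzeroParts-↭ q)

Admissible : List ℕ → Set
Admissible a = ¬ SingleOddBlock (sum a) a

Admissible-↭ : ∀ {a b} → a ↭ b → Admissible a → Admissible b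
Admissible-↭ p h (e , o) = h (trans (nonzeroParts-↭ p) e , subst Odd (sym (sum-↭ p)) o)

AM-normalized : ∀ a → AbsolutelyMonotone (normalized a)
AM-normalized []      = AM-one
AM-normalized (k ∷ a) = AM-π k (AM-normalized a)

-- Either the other parts are all zero, so that R = 1, or R has a nonconstant factor and the convex
-- case applies.
data Rest (a : List ℕ) : Set where
  empty    : sum a ≡ 0 → nonzeroParts a ≡ 0 → normalized a ≗ one → Rest a
  nonempty : Doubling (normalized a) → Rest a

rest : ∀ a → Rest a
rest []          = empty refl refl (λ _ → refl)
rest (zero ∷ a) with rest a
... | empty s z e  = empty s z e
... | nonempty d   = nonempty d
rest (suc k ∷ a) = nonempty (Doubling-π k (AM-normalized a))

odd-or-even : ∀ n → Odd n ⊎ ∃ λ k → n ≡ k ℕ.* 2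
odd-or-even zero          = inj₂ (0 , refl)
odd-or-even (suc zero)    = inj₁ odd-one
odd-or-even (suc (suc n)) with odd-or-even n
... | inj₁ o            = inj₁ (odd-ss o)
... | inj₂ (k , refl) = inj₂ (suc k , refl)

normalized-transfer : ∀ {x y} a → y ℕ.< x → Admissible (suc x ∷ y ∷ a) →
  + suc y * normalized (x ∷ suc y ∷ a) 0 ≤ + suc x * normalized (suc x ∷ y ∷ a) 0
normalized-transfer {x} {y} a y<x h with rest a
... | nonempty d = transfer-convex {normalized a} {x} {y} (AM-normalized a) d (ℕ.<⇒≤ y<x)
... | empty s z e = subst₂ (λ u v → + suc y * u ≤ + suc x * v)
    (sym (π-cong x (π-cong (suc y) e) 0)) (sym (π-cong (suc x) (π-cong y e) 0)) (pure y y<x h)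
  where
  pure : ∀ y → y ℕ.< x → Admissible (suc x ∷ y ∷ a) →
    + suc y * π x (π (suc y) one) 0 ≤ + suc x * π (suc x) (π y one) 0
  pure (suc y) y<x h = transfer-one {x} {y} (ℕ.<⇒≤ y<x)
  -- Here the move produces the single block `suc x`, and admissibility makes its size even.
  pure zero    _   h with odd-or-even (suc x)
  ... | inj₁ o = contradiction (cong suc z , subst Odd (cong suc (sym (trans (cong (x ℕ.+_) s) (ℕ.+-identityʳ x)))) o) h
  ... | inj₂ (suc k , refl) = subst (λ u → + 1 * π (suc (k ℕ.* 2)) (π 1 one) 0 ≤ + (2 ℕ.+ k ℕ.* 2) * u)
          (π-cong (2 ℕ.+ k ℕ.* 2) {one} {π 0 one} (λ _ → refl) 0) (transfer-one-even k)

weight-transfer : ∀ {x y} a → y ℕ.< x → Admissible (suc x ∷ y ∷ a) →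
  weight (x ∷ suc y ∷ a) ≤ weight (suc x ∷ y ∷ a)
weight-transfer {x} {y} a y<x h = subst₂ _≤_
  (trans (sym (*-assoc (+ K) (+ suc y) _)) (cong (_* u) (trans (sym (pos-* K (suc y))) (cong +_ (alg′ y (x !) (y !) P)))))
  (trans (sym (*-assoc (+ K) (+ suc x) _)) (cong (_* v) (trans (sym (pos-* K (suc x))) (cong +_ (alg x (x !) (y !) P)))))
  (*-monoˡ-≤-nonNeg (+ K) (normalized-transfer a y<x h))
  where
  P = product (map _! a)
  K = x ! ℕ.* (y ! ℕ.* P)
  u = normalized (x ∷ suc y ∷ a) 0
  v = normalized (suc x ∷ y ∷ a) 0
  alg : ∀ x f g p → f ℕ.* (g ℕ.* p) ℕ.* suc x ≡ (suc x ℕ.* f) ℕ.* (g ℕ.* p)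
  alg = solve-∀ℕ
  alg′ : ∀ y f g p → f ℕ.* (g ℕ.* p) ℕ.* suc y ≡ f ℕ.* ((suc y ℕ.* g) ℕ.* p)
  alg′ = solve-∀ℕ

-- s is the surplus of a over b accumulated in earlier parts. Only b will be sorted.
data Dominates : ℕ → List ℕ → List ℕ → Set where
  []  : Dominates 0 [] []
  _∷_ : ∀ {s s′ x y a b} → s ℕ.+ x ≡ y ℕ.+ s′ → Dominates s′ a b → Dominates s (x ∷ a) (y ∷ b)

-- One unit of surplus goes to the first part of `a` below its counterpart in `b`. Such a part
-- exists because the surplus ends at 0, and it is below `m` because its counterpart is at most `m`.
raise : ∀ {s a b m} → Dominates (suc s) a b → All (ℕ._≤ m) b →
  ∃₂ λ pre y → ∃ λ post → a ≡ pre ++ y ∷ post × y ℕ.< m × Dominates s (pre ++ suc y ∷ post) b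
raise {s} {x ∷ a} {y ∷ b} (e ∷ d) (y≤m ∷ h) with x ℕ.<? y
... | yes x<y = [] , x , a , refl , ℕ.≤-trans x<y y≤m , trans (ℕ.+-suc s x) e ∷ d
raise {s} {x ∷ a} {y ∷ b} (_∷_ {s′ = zero} e d) (y≤m ∷ h) | no x≮y =
  contradiction (ℕ.≤-trans (s≤s (ℕ.m≤n+m x s)) (ℕ.≤-reflexive (trans e (ℕ.+-identityʳ y)))) x≮y
raise {s} {x ∷ a} {y ∷ b} (_∷_ {s′ = suc s′} e d) (y≤m ∷ h) | no x≮y with raise d h
... | pre , z , post , refl , z<m , d′ =
  x ∷ pre , z , post , refl , z<m , ℕ.suc-injective (trans e (ℕ.+-suc y s′)) ∷ d′

Descending : List ℕ → Set
Descending = AllPairs ℕ._≥_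

front : ∀ (c : List ℕ) x pre y post → c ++ x ∷ pre ++ y ∷ post ↭ x ∷ y ∷ c ++ pre ++ post
front c x pre y post = ↭-trans (shift x c (pre ++ y ∷ post))
  (↭.prep x (↭-trans (++⁺ˡ c (shift y pre post)) (shift y c (pre ++ post))))

-- `c` collects the parts in which the two lists already agree.
weight-dominates : ∀ c {a b} → Dominates 0 a b → Descending b → Admissible (c ++ a) → weight (c ++ b) ≤ weight (c ++ a)

-- The head gives away its surplus unit by unit, each time to a part z < y found by `raise`; every
-- such move is a `weight-transfer`. The intermediate list has two nonzero parts and so stays
-- admissible.
weight-head : ∀ c s {y a b} → Dominates s a b → All (ℕ._≤ y) b → Descending b → Admissible (c ++ (y ℕ.+ s) ∷ a) →
  weight (c ++ y ∷ b) ≤ weight (c ++ (y ℕ.+ s) ∷ a)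

weight-dominates c []                     _        h = ≤-refl
weight-dominates c (_∷_ {s′ = s} refl d) (m ∷ ds) h = weight-head c s d m ds h

weight-head c zero {y} {a} {b} d m ds h = subst₂ (λ u v → weight u ≤ weight v)
  (++-assoc c (y ∷ []) b) assoc
  (weight-dominates (c ++ y ∷ []) d ds (subst Admissible (sym assoc) h))
  where
  assoc : (c ++ y ∷ []) ++ a ≡ c ++ (y ℕ.+ 0) ∷ a
  assoc = trans (++-assoc c (y ∷ []) a) (cong (λ x → c ++ x ∷ a) (sym (ℕ.+-identityʳ y)))
weight-head c (suc s) {y} {a} {b} d m ds h with raise d m
... | pre , z , post , refl , z<y , d′ = ≤-trans
  (weight-head c s d′ m ds (Admissible-↭ (↭-sym (front c (y ℕ.+ s) pre (suc z) post))
    (λ p → two-parts (y ℕ.+ s) (ℕ.≤-trans (s≤s z≤n) z<y+s) (proj₁ p))))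
  (subst₂ _≤_ (sym (weight-↭ (front c (y ℕ.+ s) pre (suc z) post)))
    (sym (trans (cong (λ x → weight (c ++ x ∷ pre ++ z ∷ post)) (ℕ.+-suc y s)) (weight-↭ (front c (suc (y ℕ.+ s)) pre z post))))
    (weight-transfer (c ++ pre ++ post) z<y+s
      (Admissible-↭ (front c (suc (y ℕ.+ s)) pre z post)
        (subst (λ x → Admissible (c ++ x ∷ pre ++ z ∷ post)) (ℕ.+-suc y s) h))))
  where
  z<y+s : z ℕ.< y ℕ.+ s
  z<y+s = ℕ.≤-trans z<y (ℕ.m≤m+n y s)
  two-parts : ∀ x {a} → 1 ℕ.≤ x → nonzeroParts (x ∷ suc z ∷ a) ≢ 1
  two-parts (suc x) _ ()

-- Sorting and padding with zeros

insertDesc-↭ : ∀ x s → insertDesc x s ↭ x ∷ s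
insertDesc-↭ x []      = ↭-refl
insertDesc-↭ x (y ∷ s) with y ℕ.≤? x
... | yes _ = ↭-refl
... | no  _ = ↭-trans (↭.prep y (insertDesc-↭ x s)) (↭.swap y x ↭-refl)

sortDesc-↭ : ∀ s → sortDesc s ↭ s
sortDesc-↭ []      = ↭-refl
sortDesc-↭ (x ∷ s) = ↭-trans (insertDesc-↭ x (sortDesc s)) (↭.prep x (sortDesc-↭ s))

insertDesc-descending : ∀ x {s} → Descending s → Descending (insertDesc x s)
insertDesc-descending x []       = [] ∷ []
insertDesc-descending x {y ∷ s} (h ∷ d) with y ℕ.≤? x
... | yes y≤x = (y≤x ∷ All.map (λ z≤y → ℕ.≤-trans z≤y y≤x) h) ∷ h ∷ d
... | no  y≰x = All-insertDesc s (ℕ.<⇒≤ (ℕ.≰⇒> y≰x)) h ∷ insertDesc-descending x d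

sortDesc-descending : ∀ s → Descending (sortDesc s)
sortDesc-descending []      = []
sortDesc-descending (x ∷ s) = insertDesc-descending x (sortDesc-descending s)

++-zeros-descending : ∀ n {s} → Descending s → Descending (s ++ replicate n 0)
++-zeros-descending n {s} d = AllPairs.++⁺ d (zeros n) (All.universal (λ _ → All.replicate⁺ n z≤n) s)
  where
  zeros : ∀ n → Descending (replicate n 0)
  zeros zero    = []
  zeros (suc n) = All.replicate⁺ n z≤n ∷ zeros n

sum-take-++-zeros : ∀ n s j → sum (take j (s ++ replicate n 0)) ≡ sum (take j s)
sum-take-++-zeros n       s       zero    = refl
sum-take-++-zeros zero    []      (suc j) = refl
sum-take-++-zeros (suc n) []      (suc j) = trans (sum-take-++-zeros n [] j) (nil j)
  where
  nil : ∀ j → sum (take j []) ≡ 0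
  nil zero    = refl
  nil (suc j) = refl
sum-take-++-zeros n       (x ∷ s) (suc j) = cong (x ℕ.+_) (sum-take-++-zeros n s j)

sum-++-zeros : ∀ n s → sum (s ++ replicate n 0) ≡ sum s
sum-++-zeros zero    []      = refl
sum-++-zeros (suc n) []      = sum-++-zeros n []
sum-++-zeros n       (x ∷ s) = cong (x ℕ.+_) (sum-++-zeros n s)

zeros-weight : ∀ n s → weight (replicate n 0 ++ s) ≡ weight s
zeros-weight zero    s = refl
zeros-weight (suc n) s = trans (cong (λ m → + m * normalized (replicate n 0 ++ s) 0) (ℕ.+-identityʳ (product (map _! (replicate n 0 ++ s))))) (zeros-weight n s)

zeros-nonzeroParts : ∀ n s → nonzeroParts (replicate n 0 ++ s) ≡ nonzeroParts s
zeros-nonzeroParts zero    s = refl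
zeros-nonzeroParts (suc n) s = zeros-nonzeroParts n s

dominates : ∀ s a b → length a ≡ length b → (∀ j → sum (take j b) ℕ.≤ s ℕ.+ sum (take j a)) →
  s ℕ.+ sum a ≡ sum b → Dominates s a b
dominates zero [] [] _ h e = []
dominates s (x ∷ a) (y ∷ b) l h e = sym (ℕ.m+[n∸m]≡n y≤s+x) ∷
  dominates (s ℕ.+ x ℕ.∸ y) a b (ℕ.suc-injective l)
    (λ j → ℕ.+-cancelˡ-≤ y _ _ (ℕ.≤-trans (h (suc j)) (ℕ.≤-reflexive (regroup (sum (take j a))))))
    (ℕ.+-cancelˡ-≡ y _ _ (trans (sym (regroup (sum a))) e))
  where
  y≤s+x : y ℕ.≤ s ℕ.+ x
  y≤s+x = subst₂ ℕ._≤_ (ℕ.+-identityʳ y) (cong (s ℕ.+_) (ℕ.+-identityʳ x)) (h 1)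
  regroup : ∀ z → s ℕ.+ (x ℕ.+ z) ≡ y ℕ.+ (s ℕ.+ x ℕ.∸ y ℕ.+ z)
  regroup z = trans (sym (ℕ.+-assoc s x z)) (trans (cong (ℕ._+ z) (sym (ℕ.m+[n∸m]≡n y≤s+x)))
    (ℕ.+-assoc y (s ℕ.+ x ℕ.∸ y) z))

theorem4 : (n : ℕ) (a b : List ℕ) → IsComposition n a → IsComposition n b →
    a ⊵ b → ¬ SingleOddBlock n a →
    preimageCount n a ≥ preimageCount n b
theorem4 n a b ea eb a⊵b notOdd = drop‿+≤+ (subst₂ _≤_
  (trans (weight-padded b (length A)) (sym (preimageCount-weight n b eb)))
  (trans (weight-padded a (length B)) (sym (preimageCount-weight n a ea)))
  (weight-dominates []
    (dominates 0 A⁺ B⁺ lengths prefix (trans (sum-padded a (length B)) (trans ea (sym (trans (sum-padded b (length A)) eb)))))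
    (++-zeros-descending (length A) (sortDesc-descending b))
    (λ { (p , o) → notOdd
      ( trans (sym (trans (nonzeroParts-↭ (padded-↭ a (length B))) (zeros-nonzeroParts (length B) a))) p
      , subst Odd (trans (sum-padded a (length B)) ea) o) })))
  where
  A = sortDesc a
  B = sortDesc b
  -- Padding each list by the length of the other makes the lengths equal; zero parts change neither
  -- weights nor admissibility.
  A⁺ = A ++ replicate (length B) 0
  B⁺ = B ++ replicate (length A) 0

  padded-↭ : ∀ s k → sortDesc s ++ replicate k 0 ↭ replicate k 0 ++ s
  padded-↭ s k = ↭-trans (++-comm (sortDesc s) (replicate k 0)) (++⁺ˡ (replicate k 0) (sortDesc-↭ s))

  weight-padded : ∀ s k → weight (sortDesc s ++ replicate k 0) ≡ weight s
  weight-padded s k = trans (weight-↭ (padded-↭ s k)) (zeros-weight k s)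

  sum-padded : ∀ s k → sum (sortDesc s ++ replicate k 0) ≡ sum s
  sum-padded s k = trans (sum-++-zeros k (sortDesc s)) (sum-↭ (sortDesc-↭ s))

  lengths : length A⁺ ≡ length B⁺
  lengths = trans (length-++ A) (trans (cong (length A ℕ.+_) (length-replicate (length B)))
    (trans (ℕ.+-comm (length A) (length B)) (sym (trans (length-++ B) (cong (length B ℕ.+_) (length-replicate (length A)))))))

  prefix : ∀ j → sum (take j B⁺) ℕ.≤ sum (take j A⁺)
  prefix j = subst₂ ℕ._≤_ (sym (sum-take-++-zeros (length A) B j)) (sym (sum-take-++-zeros (length B) A j)) (a⊵b j)
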